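{- Let $d\ge 2$, let $a,p,m,k,N$ be nonzero integers (with $N>0$) such that $\gcd(m,p)=1$, $\gcd(ap,N)=1$ and $(am^d-kN)/p$ is a nonzero integer, and let $s$ be a positive integer. Then the polynomials $f_1,f_2$ returned by Algorithm B on these inputs satisfy $$\|f_i\|_{2,s}\le s^{ -\frac{\deg f_i}{2}}\left(2^{\frac{d(d-1)}{4}}s^{\frac{d^2}{2}}(\tilde{a}/a)\,\|\vec{c}\|_{2,s^{ -1}}\right)^{\frac{1}{d-i+1}},\qquad i=1,2,$$ where $\vec{c}=[c_0,\dots,c_d]=\left[ap^{d-1},ap^{d-2}m,\dots,am^{d-1},\frac{am^d-kN}{p}\right]$ and $\tilde{a}=a/\gcd(a,c_d)$.
   Context: For a real polynomial $h=\sum_{i=0}^{e}h_ix^i$ of degree $e$, $\|h\|_{2,s}=\left(\sum_{i=0}^{e}|h_is^{\,i-e/2}|^2\right)^{1/2}$. For $\vec{x}=(x_0,\dots,x_d)\in\mathbb{R}^{d+1}$, $\|\vec{x}\|_{2,s^{ -1}}=s^{d/2}\left(\sum_{i=0}^{d}x_i^2s^{ -2i}\right)^{1/2}$. Algorithm A. Input: nonzero integers $m,p,\tilde{k},N$ with $\gcd(m,p)=1$, and integers $a_j,\dots,a_n$ with $1\le j\le n$ such that $p^{n-j+1}$ divides $\tilde{k}N-\sum_{i=j}^{n}a_im^ip^{n-i}$. Steps: (1) If $j=n$ set $r_j=\tilde{k}N$; otherwise $r_j=\left(\tilde{k}N-\sum_{i=j+1}^{n}a_im^ip^{n-i}\right)/p^{n-j}$.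 (2) For $i=j-1,\dots,0$ compute $r_i=(r_{i+1}-a_{i+1}m^{i+1})/p$ and $a_i=(r_i+t_ip)/m^i$, where $t_i\in[-m^i/2,m^i/2)\cap\mathbb{Z}$, $t_i\equiv -r_i/p\pmod{m^i}$. (3) Return $\sum_{i=0}^n a_ix^i$, which satisfies $\tilde{f}(m/p)p^n=\tilde{k}N$. Algorithm B (inputs $d,a,p,m,k,N,s$ as in the claim). (1) Compute $g=\gcd(a,(am^d-kN)/p)$ and apply Algorithm A with $n=j=d$, $a_n=a/g$ and $\tilde{k}=k/g$ to obtain $\tilde{f}=\sum_{i=0}^d a_ix^i$ with $\tilde{f}(m/p)p^d=\tilde{k}N$. (2) Let $B$ be the $d\times(d+1)$ integer matrix whose first row is $(a_0,\dots,a_d)$ and whose remaining rows are the coefficient vectors (constant term first, length $d+1$) of $x^{d-2}(px-m),x^{d-3}(px-m),\dots,x(px-m),(px-m)$, in this order. Let $S=\mathrm{diag}(1,s,\dots,s^d)$. Compute an LLL-reduced basis $(\vec{b}_1,\dots,\vec{b}_d)$ (in the sense of Lenstra–Lenstra–Lovász) of the lattice with basis matrix $BS$. (3) Writing $\vec{b}_i=(b_{i,0},\dots,b_{i,d})S$ for $i=1,2$, return $f_1=\sum_{j=0}^d b_{1,j}x^j$ and $f_2=\sum_{j=0}^d b_{2,j}x^j$. -}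

module Defs where

open import Data.Nat as ℕ using (ℕ; zero; suc; _∸_; _<_; _≤_)
open import Data.Integer as ℤ using (ℤ; +_; -[1+_])
open import Data.Rational as ℚ using (ℚ; 0ℚ; 1ℚ; _+_; _*_; _-_)
open import Relation.Nullary using (yes; no)
open import Relation.Binary.PropositionalEquality using (_≡_)
open import Data.Product using (Σ; _×_)

-- total division on ℚ (x ÷₀ 0 = 0); only ever used with nonzero divisors
_÷₀_ : ℚ → ℚ → ℚ
p ÷₀ q with q ℚ.≟ 0ℚ
... | yes _ = 0ℚ
... | no q≢0 = ℚ._÷_ p q {{ℚ.≢-nonZero q≢0}}

_^ℚ_ : ℚ → ℕ → ℚ
q ^ℚ zero = 1ℚ
q ^ℚ suc n = q * (q ^ℚ n)

_^ℤ_ : ℚ → ℤ → ℚ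
q ^ℤ (+ n) = q ^ℚ n
q ^ℤ -[1+ n ] = 1ℚ ÷₀ (q ^ℚ suc n)

ℤ→ℚ : ℤ → ℚ
ℤ→ℚ z = z ℚ./ 1

ℕ→ℚ : ℕ → ℚ
ℕ→ℚ n = (+ n) ℚ./ 1

ΣQ : ℕ → (ℕ → ℚ) → ℚ
ΣQ zero f = 0ℚ
ΣQ (suc n) f = ΣQ n f + f n

ΣZ : ℕ → (ℕ → ℤ) → ℤ
ΣZ zero f = + 0
ΣZ (suc n) f = ΣZ n f ℤ.+ f n

-- Polynomials: a polynomial with at most n coefficients is a function
-- h : ℕ → ℤ, h i = coefficient of x^i (only i < n is read).

-- degree: largest i < n with h i ≠ 0 (0 for the zero polynomial)
deg : ℕ → (ℕ → ℤ) → ℕ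
deg zero h = 0
deg (suc n) h with h n ℤ.≟ + 0
... | no _ = n
... | yes _ = deg n h

-- ‖h‖_{2,s}^2 = Σ_{i=0}^{e} (h_i s^{i - e/2})^2 = Σ_{i=0}^{e} h_i^2 s^{2i-e},
-- e = deg h, where h has (at most) n coefficients
norm2s² : ℕ → (ℕ → ℤ) → ℕ → ℚ
norm2s² n h s =
  ΣQ (suc (deg n h)) (λ i →
    ℤ→ℚ (h i) * ℤ→ℚ (h i) * (ℕ→ℚ s ^ℤ (+ (2 ℕ.* i) ℤ.- + deg n h)))

norm2sInv² : ℕ → (ℕ → ℤ) → ℕ → ℚ
norm2sInv² d x s =
  (ℕ→ℚ s ^ℚ d) * ΣQ (suc d) (λ i →
    ℤ→ℚ (x i) * ℤ→ℚ (x i) * (ℕ→ℚ s ^ℤ (ℤ.- (+ (2 ℕ.* i)))))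

-- Algorithm A with n = j = d (as called in step (1) of Algorithm B),
-- specified by its defining equations (all divisions are exact; t_i is
-- the representative in [-|m^i|/2, |m^i|/2) of -r_i/p mod m^i).
-- The output is the coefficient vector a_0,...,a_d (function acoef).

record AlgorithmA (d : ℕ) (m p kt N ad : ℤ) (acoef r t : ℕ → ℤ) : Set where
  field
    top-coef : acoef d ≡ ad
    r-top    : r d ≡ kt ℤ.* N
    r-step   : ∀ i → i < d → p ℤ.* r i ≡ r (suc i) ℤ.- acoef (suc i) ℤ.* (m ℤ.^ suc i)
    a-step   : ∀ i → i < d → (m ℤ.^ i) ℤ.* acoef i ≡ r i ℤ.+ t i ℤ.* p
    t-low    : ∀ i → i < d → ℤ.- (+ ℤ.∣ m ℤ.^ i ∣) ℤ.≤ (+ 2) ℤ.* t i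
    t-high   : ∀ i → i < d → (+ 2) ℤ.* t i ℤ.< + ℤ.∣ m ℤ.^ i ∣

-- The matrix B of Algorithm B (rows r < d, columns j ≤ d):
-- row 0 = (a_0,...,a_d); row r ≥ 1 = coefficients of x^{d-1-r}(px - m).

matB : ℕ → ℤ → ℤ → (ℕ → ℤ) → ℕ → ℕ → ℤ
matB d p m acoef zero j = acoef j
matB d p m acoef (suc r') j with j ℕ.≟ (d ∸ suc r') | suc j ℕ.≟ (d ∸ suc r')
... | yes _ | _     = p
... | no _  | yes _ = ℤ.- m
... | no _  | no _  = + 0

RowSpanIn : ℕ → (ℕ → ℕ → ℤ) → (ℕ → ℕ → ℤ) → Set
RowSpanIn d C B =
  Σ (ℕ → ℕ → ℤ) λ U → ∀ i j → i < d → j ≤ d →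
    C i j ≡ ΣZ d (λ r → U i r ℤ.* B r j)

-- Gram–Schmidt and LLL-reducedness (δ = 3/4) for rows b 0,...,b (k-1)
-- of vectors in ℚ^n (vectors are functions ℕ → ℚ, entries j < n).

Vecℚ : Set
Vecℚ = ℕ → ℚ

dot : ℕ → Vecℚ → Vecℚ → ℚ
dot n u v = ΣQ n (λ j → u j * v j)

-- gsUpTo n b k l = b*_l for l < k
gsUpTo : ℕ → (ℕ → Vecℚ) → ℕ → ℕ → Vecℚ
gsUpTo n b zero l = λ _ → 0ℚ
gsUpTo n b (suc k) l with l ℕ.<? k
... | yes _ = gsUpTo n b k l
... | no _  = λ j → b k j - ΣQ k (λ l' →
                 (dot n (b k) (gsUpTo n b k l') ÷₀ dot n (gsUpTo n b k l') (gsUpTo n b k l'))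
                 * gsUpTo n b k l' j)

gs : ℕ → (ℕ → Vecℚ) → ℕ → Vecℚ
gs n b i = gsUpTo n b (suc i) i

μ : ℕ → (ℕ → Vecℚ) → ℕ → ℕ → ℚ
μ n b i j = dot n (b i) (gs n b j) ÷₀ dot n (gs n b j) (gs n b j)

-- LLL-reduced (Lenstra–Lenstra–Lovász, conditions (1.4), (1.5)), k vectors
record LLLReduced (n k : ℕ) (b : ℕ → Vecℚ) : Set where
  field
    size-reduced : ∀ i j → j < i → i < k → ℚ.∣ μ n b i j ∣ ℚ.≤ ℚ.½
    lovasz : ∀ i → 1 ≤ i → i < k →
      ((+ 3) ℚ./ 4) * dot n (gs n b (i ∸ 1)) (gs n b (i ∸ 1))
        ℚ.≤ dot n (λ j → gs n b i j + μ n b i (i ∸ 1) * gs n b (i ∸ 1) j)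
                  (λ j → gs n b i j + μ n b i (i ∸ 1) * gs n b (i ∸ 1) j)

-- rows of an integer matrix M multiplied on the right by S = diag(1,s,...,s^d)
scaleRows : (ℕ → ℕ → ℤ) → ℕ → ℕ → Vecℚ
scaleRows M s i j = ℤ→ℚ (M i j) * (ℕ→ℚ s ^ℚ j)

-- C S (with C a d×(d+1) integer matrix) is an LLL-reduced basis of the
-- lattice with basis matrix B S.  Every vector of that lattice is of the
-- form (integer row vector) S, so the basis is given by C.
IsLLLBasisOf : ℕ → ℕ → (ℕ → ℕ → ℤ) → (ℕ → ℕ → ℤ) → Set
IsLLLBasisOf d s B C =
  RowSpanIn d C B × RowSpanIn d B C × LLLReduced (suc d) d (scaleRows C s)

cvec : ℕ → ℤ → ℤ → ℤ → ℤ → ℕ → ℤ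
cvec d a p m cd i with i ℕ.<? d
... | yes _ = a ℤ.* (p ℤ.^ (d ∸ suc i)) ℤ.* (m ℤ.^ i)
... | no _  = cd

{-# OPTIONS --safe #-}
module Submission where

-- The vector w = (c_j s^{d-j})_j is orthogonal to the whole lattice, so stacking it on top of a basis gives a square matrix whose squared determinant
-- is |w|² times the squared covolume, i.e. |w|² Π |b*_i|².  For the explicit basis this determinant
-- is read off after one column operation using w itself, because the remaining block is triangular
-- with diagonal p s, …, p s^{d-1}, ã s^d; this gives Π |b*_i|² = (ã/a)² s^{d²} ‖c‖²_{2,s⁻¹}
-- (only ≤ is needed).  An LLL-reduced basis has |b*_i|² ≤ 2 |b*_{i+1}|², hence |b_1|² ≤ 2^i |b*_{i+1}|²
-- for i ≥ 0 and |b_2|² ≤ 2^i |b*_{i+1}|² for i ≥ 1.  Multiplying these bounds gives the claim for f_1,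
-- and also for f_2 because |b*_1|² = |b_1|² is a positive integer.

open import Defs
open import Algebra.Bundles using (CommutativeRing)
open import Data.Nat as ℕ using (ℕ; zero; suc; _∸_; _≤_; _<_; z≤n; s≤s)
import Data.Nat.Properties as ℕₚ
open import Data.Nat.Coprimality using (1-coprimeTo) renaming (sym to coprime-sym)
open import Data.Nat.DivMod using (m*n/n≡m)
open import Data.Nat.Solver using () renaming (module +-*-Solver to ℕ-Solver)
open import Data.Integer as ℤ using (ℤ; +_; -[1+_])
import Data.Integer.Properties as ℤₚ
open import Data.Integer.GCD using (gcd)
open import Data.Integer.Solver using () renaming (module +-*-Solver to ℤ-Solver)
open import Data.Rational as ℚ using (ℚ; 0ℚ; 1ℚ; _+_; _*_; _-_; -_; mkℚ; *≤*; *<*)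
import Data.Rational.Properties as ℚₚ
import Data.Rational.Unnormalised as ℚᵘ
import Data.Rational.Unnormalised.Properties as ℚᵘₚ
open import Data.Rational.Solver using (module +-*-Solver)
open import Data.Fin using (Fin; zero; suc; toℕ; fromℕ<; inject₁; punchIn; punchOut)
import Data.Fin.Properties as Finₚ
open import Data.Fin.Induction using (<-weakInduction)
open import Data.Vec.Functional using (_∷_; updateAt)
open import Data.Vec.Functional.Properties using (updateAt-updates; updateAt-minimal)
open import Data.Product using (∃; ∃₂; _×_; _,_; proj₁; proj₂)
open import Data.Sum using (inj₁; inj₂; [_,_]′)
open import Data.Empty using (⊥-elim)
open import Function using (const; id; _∘_)
open import Relation.Nullary using (yes; no)
open import Relation.Binary.Definitions using (tri<; tri≈; tri>)
open import Relation.Binary.PropositionalEquality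

open import Algebra.Properties.Semiring.Sum (CommutativeRing.semiring ℚₚ.+-*-commutativeRing)
  using (sum; sum-cong-≗; ∑-distrib-+; *-distribˡ-sum; sum-replicate-zero)
open import Algebra.Properties.CommutativeMonoid.Sum ℚₚ.*-1-commutativeMonoid using ()
  renaming (sum to prod; sum-cong-≗ to prod-cong)

open +-*-Solver using (solve; _:=_; _:+_; _:*_; _:-_; :-_; con)
open ℕ-Solver using ()
  renaming (solve to solveℕ; con to conℕ; _:+_ to infixl 6 _⊕_; _:*_ to infixl 7 _⊛_; _:=_ to infix 4 _⊜_)
open ℤ-Solver using ()
  renaming (solve to solveℤ; con to conℤ; _:+_ to infixl 6 _⊞_; _:-_ to infixl 6 _⊟_; _:*_ to infixl 7 _⊠_; :-_ to infix 8 ⊟_; _:=_ to infix 4 _≜_)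

-- No roots occur: raising the claim to the power 2(d-i+1) leaves an inequality between rationals,
-- in which s^e ‖f_i‖², with e = deg f_i, is the squared length of the reduced vector. The lattice
-- has rank d in dimension d+1, so its covolume is not the determinant of a basis matrix. The extra
-- row `w` makes all matrices square at the price of a factor |w|². Orthogonality to `w` rests on
-- two facts. The entries c_0, ..., c_{d-1} form a geometric progression with ratio m/p, which kills
-- every x^i(px - m). For the polynomial row, the recursion of Algorithm A is a Horner scheme with
-- Σ_{j<d} a_j p^{d-1-j} m^j = r_{d-1}, and a r_{d-1} + ã c_d = 0 because a and k are divided by the
-- same g. What is needed of the determinant is above all multiplicativity; it is derived from the
-- fact that an alternating form vanishing at the identity vanishes everywhere.

private variable
  k n : ℕ

-- Determinants

Mat : ℕ → ℕ → Set
Mat k n = Fin k → Fin n → ℚ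

infix 4 _≐_
_≐_ : Mat k n → Mat k n → Set
A ≐ B = ∀ i j → A i j ≡ B i j

sum-zero : {f : Fin n → ℚ} → (∀ i → f i ≡ 0ℚ) → sum f ≡ 0ℚ
sum-zero {n} f≡0 = trans (sum-cong-≗ f≡0) (sum-replicate-zero n)

sum-linear : ∀ x {f g h : Fin n → ℚ} → (∀ i → f i ≡ x * g i + h i) → sum f ≡ x * sum g + sum h
sum-linear x {f} {g} {h} eq = begin
  sum f                                ≡⟨ sum-cong-≗ eq ⟩
  sum (λ i → x * g i + h i)            ≡⟨ ∑-distrib-+ (λ i → x * g i) h ⟩
  sum (λ i → x * g i) + sum h          ≡⟨ cong (_+ sum h) (*-distribˡ-sum x g) ⟨
  x * sum g + sum h                    ∎
  where open ≡-Reasoning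

-- Adjacency is inductive so that it recurses in step with `punchIn` and with removal of the first
-- row. Alternation is demanded for adjacent rows only, as the column expansion delivers it;
-- `vanish-next` later carries vanishing to distant rows.
data Next : Fin k → Fin k → Set where
  here  : Next {suc (suc k)} zero (suc zero)
  there : {i i′ : Fin k} → Next i i′ → Next (suc i) (suc i′)

next-inject₁ : (i : Fin k) → Next (inject₁ i) (suc i)
next-inject₁ zero    = here
next-inject₁ (suc i) = there (next-inject₁ i)

next⇒≢ : {i i′ : Fin k} → Next i i′ → i ≢ i′
next⇒≢ here       ()
next⇒≢ (there nx) refl = next⇒≢ nx refl

AgreeOff : Fin k → Mat k n → Mat k n → Set
AgreeOff i A B = ∀ r → r ≢ i → ∀ j → A r j ≡ B r j

-- Matrices are functions, so row operations are described by pointwise hypotheses on `A`, `B`, `C`,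
-- and `respects` stands in for extensionality. Additivity and homogeneity in a row are merged into
-- the one combination x A + B.
record Alternating (F : Mat k n → ℚ) : Set where
  field
    respects    : ∀ {A B} → A ≐ B → F A ≡ F B
    linear      : ∀ i x {A B C} → AgreeOff i C A → AgreeOff i C B →
                  (∀ j → C i j ≡ x * A i j + B i j) → F C ≡ x * F A + F B
    alternating : ∀ {i i′} → Next i i′ → ∀ {A} → (∀ j → A i j ≡ A i′ j) → F A ≡ 0ℚ

sgn : Fin n → ℚ
sgn zero    = 1ℚ
sgn (suc i) = - sgn i

sgn-next : {i i′ : Fin k} → Next i i′ → sgn i′ ≡ - sgn i
sgn-next here       = refl
sgn-next (there nx) = cong -_ (sgn-next nx)

minor : Mat (suc n) (suc n) → Fin (suc n) → Mat n n
minor A r i j = A (punchIn r i) (suc j)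

-- Expanding along the first column makes alternation in the rows immediate: deleting
-- either of two equal adjacent rows leaves the same matrix.
det : Mat n n → ℚ
det {zero}  A = 1ℚ
det {suc n} A = sum (λ r → sgn r * A r zero * det (minor A r))

det-cong : {A B : Mat n n} → A ≐ B → det A ≡ det B
det-cong {zero}  eq = refl
det-cong {suc n} eq = sum-cong-≗ λ r →
  cong₂ (λ x y → sgn r * x * y) (eq r zero) (det-cong λ i j → eq (punchIn r i) (suc j))

-- The expansion term that deletes row `i` is linear through its entry, and its minor does not see
-- row `i`. Every other term keeps its entry, and its minor is linear by induction, at the position
-- that `punchOut` assigns to `i`.
det-linear : ∀ (i : Fin n) x {A B C : Mat n n} → AgreeOff i C A → AgreeOff i C B →
             (∀ j → C i j ≡ x * A i j + B i j) → det C ≡ x * det A + det B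
det-linear {suc n} i x {A} {B} {C} CA CB eq = sum-linear x term
  where
  minor-linear : ∀ r → r ≢ i → det (minor C r) ≡ x * det (minor A r) + det (minor B r)
  minor-linear r r≢i = det-linear i′ x
    (λ l l≢i′ j → CA _ (off l≢i′) (suc j)) (λ l l≢i′ j → CB _ (off l≢i′) (suc j))
    (λ j → subst (λ l → C l (suc j) ≡ x * A l (suc j) + B l (suc j)) (sym in-i′) (eq (suc j)))
    where
    i′ = punchOut r≢i
    in-i′ : punchIn r i′ ≡ i
    in-i′ = Finₚ.punchIn-punchOut r≢i
    off : ∀ {l} → l ≢ i′ → punchIn r l ≢ i
    off l≢i′ e = l≢i′ (Finₚ.punchIn-injective r _ _ (trans e (sym in-i′)))
  term : ∀ r → sgn r * C r zero * det (minor C r)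
             ≡ x * (sgn r * A r zero * det (minor A r)) + sgn r * B r zero * det (minor B r)
  term r with r Finₚ.≟ i
  ... | yes refl
    rewrite eq zero
          | det-cong {A = minor A r} {minor C r} (λ j l → sym (CA _ (Finₚ.punchInᵢ≢i r j) (suc l)))
          | det-cong {A = minor B r} {minor C r} (λ j l → sym (CB _ (Finₚ.punchInᵢ≢i r j) (suc l)))
    = solve 5 (λ s x a b D → s :* (x :* a :+ b) :* D := x :* (s :* a :* D) :+ s :* b :* D) refl
        (sgn r) x (A r zero) (B r zero) (det (minor C r))
  ... | no r≢i
    rewrite sym (CA r r≢i zero) | sym (CB r r≢i zero) | minor-linear r r≢i
    = solve 5 (λ s x c D E → s :* c :* (x :* D :+ E) := x :* (s :* c :* D) :+ s :* c :* E) refl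
        (sgn r) x (C r zero) (det (minor A r)) (det (minor B r))

next-punchIn : {i i′ r : Fin (suc k)} → Next i i′ → r ≢ i → r ≢ i′ →
               ∃₂ λ j j′ → Next j j′ × punchIn r j ≡ i × punchIn r j′ ≡ i′
next-punchIn {r = zero}         here r≢i _    = ⊥-elim (r≢i refl)
next-punchIn {r = suc zero}     here _   r≢i′ = ⊥-elim (r≢i′ refl)
next-punchIn {r = suc (suc r)}  here _   _    = lemma r
  where
  lemma : ∀ {k} (r : Fin k) → ∃₂ λ j j′ → Next j j′ × punchIn (suc (suc r)) j ≡ zero
                                              × punchIn (suc (suc r)) j′ ≡ suc zero
  lemma zero    = zero , suc zero , here , refl , refl
  lemma (suc r) = zero , suc zero , here , refl , refl
next-punchIn {suc k} {r = zero}  (there nx) _ _ = _ , _ , nx , refl , refl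
next-punchIn {suc k} {r = suc r} (there nx) r≢i r≢i′
  with next-punchIn nx (r≢i ∘ cong suc) (r≢i′ ∘ cong suc)
... | j , j′ , nx′ , e , e′ = suc j , suc j′ , there nx′ , cong suc e , cong suc e′

next-delete : ∀ {X : Set} (g : Fin (suc k) → X) {i i′} → Next i i′ → g i ≡ g i′ →
              ∀ r → g (punchIn i r) ≡ g (punchIn i′ r)
next-delete g here       e zero    = sym e
next-delete g here       e (suc r) = refl
next-delete {suc k} g (there nx) e zero    = refl
next-delete {suc k} g (there nx) e (suc r) = next-delete (g ∘ suc) nx e r

sum-next : {f : Fin k → ℚ} {i i′ : Fin k} → Next i i′ → (∀ r → r ≢ i → r ≢ i′ → f r ≡ 0ℚ) →
           f i + f i′ ≡ 0ℚ → sum f ≡ 0ℚ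
sum-next {f = f} here rest e = begin
  f zero + (f (suc zero) + sum (λ r → f (suc (suc r))))
    ≡⟨ cong (λ z → f zero + (f (suc zero) + z)) (sum-zero λ r → rest (suc (suc r)) (λ ()) (λ ())) ⟩
  f zero + (f (suc zero) + 0ℚ)
    ≡⟨ cong (λ z → f zero + z) (ℚₚ.+-identityʳ _) ⟩
  f zero + f (suc zero)
    ≡⟨ e ⟩
  0ℚ ∎
  where open ≡-Reasoning
sum-next (there nx) rest e = trans
  (cong₂ _+_ (rest zero (λ ()) (λ ()))
    (sum-next nx (λ r r≢i r≢i′ → rest (suc r) (r≢i ∘ Finₚ.suc-injective) (r≢i′ ∘ Finₚ.suc-injective)) e))
  (ℚₚ.+-identityˡ 0ℚ)

-- A minor that deletes neither row still contains both, still adjacent, and vanishes by induction.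
-- The two remaining terms have equal entries, equal minors and opposite signs.
det-alternates : {i i′ : Fin n} → Next i i′ → {A : Mat n n} → (∀ j → A i j ≡ A i′ j) → det A ≡ 0ℚ
det-alternates {suc n} {i} {i′} nx {A} eq = sum-next nx others cancel
  where
  others : ∀ r → r ≢ i → r ≢ i′ → sgn r * A r zero * det (minor A r) ≡ 0ℚ
  others r r≢i r≢i′ with next-punchIn nx r≢i r≢i′
  ... | j , j′ , nx′ , refl , refl =
    trans (cong (sgn r * A r zero *_) (det-alternates nx′ (λ l → eq (suc l)))) (ℚₚ.*-zeroʳ (sgn r * A r zero))
  cancel : sgn i * A i zero * det (minor A i) + sgn i′ * A i′ zero * det (minor A i′) ≡ 0ℚ
  cancel
    rewrite sgn-next nx | eq zero
          | det-cong {A = minor A i} {minor A i′} (λ r j → next-delete (λ l → A l (suc j)) nx (eq (suc j)) r)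
    = solve 3 (λ s a D → s :* a :* D :+ (:- s) :* a :* D := con 0ℚ) refl
        (sgn i) (A i′ zero) (det (minor A i′))

det-isAlternating : ∀ n → Alternating (det {n})
det-isAlternating n = record
  { respects = det-cong ; linear = det-linear ; alternating = det-alternates }

-- Vanishing criteria for alternating forms

infixl 6 _[_≔_]
_[_≔_] : Mat k n → Fin k → (Fin n → ℚ) → Mat k n
A [ i ≔ u ] = updateAt A i (const u)

e₀ : Fin (suc n) → ℚ
e₀ = 1ℚ ∷ λ _ → 0ℚ

pad : Mat k n → Mat k (suc n)
pad A i = 0ℚ ∷ A i

I : Mat n n
I zero    zero    = 1ℚ
I zero    (suc j) = 0ℚ
I (suc i) zero    = 0ℚ
I (suc i) (suc j) = I i j

module _ {F : Mat k n → ℚ} (alt : Alternating F) where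
  open Alternating alt

  -- A zero row satisfies 0 = 1·0 + 0, so linearity gives F A = F A + F A.
  vanish-zero-row : ∀ i {A} → (∀ j → A i j ≡ 0ℚ) → F A ≡ 0ℚ
  vanish-zero-row i {A} A≡0 = begin
    F A             ≡⟨ solve 1 (λ x → x := con 1ℚ :* x :+ x :- x) refl (F A) ⟩
    1ℚ * F A + F A - F A ≡⟨ cong (_- F A) (linear i 1ℚ {A} {A} {A} (λ _ _ _ → refl) (λ _ _ _ → refl)
                          (λ j → trans (A≡0 j) (sym (cong (λ z → 1ℚ * z + z) (A≡0 j))))) ⟨
    F A - F A       ≡⟨ ℚₚ.+-inverseʳ (F A) ⟩
    0ℚ              ∎
    where open ≡-Reasoning

  -- Polarisation: with `w` = A_i + u, the matrix `S` has `w` in both rows and vanishes. Expanding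
  -- its row `i` splits off `U`, which has `u` in row `i`; expanding row `i′` then splits off `V`,
  -- which has A_i in both rows. What remains is `A` itself.
  vanish-next : ∀ {i i′} {u : Fin n → ℚ} → Next i i′ →
                (∀ A → (∀ j → A i j ≡ u j) → F A ≡ 0ℚ) → ∀ A → (∀ j → A i′ j ≡ u j) → F A ≡ 0ℚ
  vanish-next {i} {i′} {u} nx vanish A Ai′≡u = begin
    F A                   ≡⟨ solve 1 (λ x → x := con 1ℚ :* con 0ℚ :+ x) refl (F A) ⟩
    1ℚ * 0ℚ + F A         ≡⟨ cong (λ z → 1ℚ * z + F A) FV≡0 ⟨
    1ℚ * F V + F A        ≡⟨ linear i′ 1ℚ {V} {A} {T} TV TA Ti′ ⟨
    F T                   ≡⟨ solve 1 (λ x → x := con 1ℚ :* x :+ con 0ℚ) refl (F T) ⟩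
    1ℚ * F T + 0ℚ         ≡⟨ cong (λ z → 1ℚ * F T + z) FU≡0 ⟨
    1ℚ * F T + F U        ≡⟨ linear i 1ℚ {T} {U} {S} ST SU Si ⟨
    F S                   ≡⟨ FS≡0 ⟩
    0ℚ                    ∎
    where
    open ≡-Reasoning
    w : Fin n → ℚ
    w j = A i j + u j
    i≢i′ = next⇒≢ nx
    T = A [ i′ ≔ w ]
    S = T [ i ≔ w ]
    U = T [ i ≔ u ]
    V = A [ i′ ≔ A i ]
    Ti : T i ≡ A i
    Ti = updateAt-minimal i i′ A i≢i′
    TV : AgreeOff i′ T V
    TV r r≢ j = cong (λ f → f j) (trans (updateAt-minimal r i′ A r≢) (sym (updateAt-minimal r i′ A r≢)))
    TA : AgreeOff i′ T A
    TA r r≢ j = cong (λ f → f j) (updateAt-minimal r i′ A r≢)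
    Ti′ : ∀ j → T i′ j ≡ 1ℚ * V i′ j + A i′ j
    Ti′ j rewrite updateAt-updates i′ {f = const w} A | updateAt-updates i′ {f = const (A i)} A | Ai′≡u j =
      cong (_+ u j) (sym (ℚₚ.*-identityˡ (A i j)))
    FV≡0 : F V ≡ 0ℚ
    FV≡0 = alternating nx λ j → cong (λ f → f j)
      (trans (updateAt-minimal i i′ A i≢i′) (sym (updateAt-updates i′ A)))
    ST : AgreeOff i S T
    ST r r≢ j = cong (λ f → f j) (updateAt-minimal r i T r≢)
    SU : AgreeOff i S U
    SU r r≢ j = cong (λ f → f j) (trans (updateAt-minimal r i T r≢) (sym (updateAt-minimal r i T r≢)))
    Si : ∀ j → S i j ≡ 1ℚ * T i j + U i j
    Si j rewrite updateAt-updates i {f = const w} T | updateAt-updates i {f = const u} T | Ti =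
      cong (_+ u j) (sym (ℚₚ.*-identityˡ (A i j)))
    FU≡0 : F U ≡ 0ℚ
    FU≡0 = vanish U λ j → cong (λ f → f j) (updateAt-updates i T)
    FS≡0 : F S ≡ 0ℚ
    FS≡0 = alternating nx λ j → cong (λ f → f j) (trans (updateAt-updates i T)
      (sym (trans (updateAt-minimal i′ i T (i≢i′ ∘ sym)) (updateAt-updates i′ A))))

vanish-anywhere : {F : Mat (suc k) n → ℚ} → Alternating F → {u : Fin n → ℚ} →
                  (∀ A → (∀ j → A zero j ≡ u j) → F A ≡ 0ℚ) →
                  ∀ i A → (∀ j → A i j ≡ u j) → F A ≡ 0ℚ
vanish-anywhere {F = F} alt {u} vanish = <-weakInduction
  (λ i → ∀ A → (∀ j → A i j ≡ u j) → F A ≡ 0ℚ) vanish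
  (λ i vanish-i → vanish-next alt (next-inject₁ i) vanish-i)

∷-alternating : {F : Mat (suc k) n → ℚ} → Alternating F → ∀ u → Alternating (λ R → F (u ∷ R))
∷-alternating alt u = record
  { respects    = λ eq → respects λ { zero j → refl ; (suc i) j → eq i j }
  ; linear      = λ i x CA CB eq → linear (suc i) x
      (λ { zero _ j → refl ; (suc r) r≢ j → CA r (r≢ ∘ cong suc) j })
      (λ { zero _ j → refl ; (suc r) r≢ j → CB r (r≢ ∘ cong suc) j }) eq
  ; alternating = λ nx eq → alternating (there nx) eq
  }
  where open Alternating alt

pad-alternating : {F : Mat k (suc n) → ℚ} → Alternating F → Alternating (λ A → F (pad A))
pad-alternating alt = record
  { respects    = λ eq → respects λ { i zero → refl ; i (suc j) → eq i j }
  ; linear      = λ i x CA CB eq → linear i x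
      (λ { r r≢ zero → refl ; r r≢ (suc j) → CA r r≢ j })
      (λ { r r≢ zero → refl ; r r≢ (suc j) → CB r r≢ j })
      (λ { zero → solve 1 (λ x → con 0ℚ := x :* con 0ℚ :+ con 0ℚ) refl x ; (suc j) → eq j })
  ; alternating = λ nx eq → alternating nx λ { zero → refl ; (suc j) → eq j }
  }
  where open Alternating alt

vanish-repeated : {F : Mat (suc k) n → ℚ} → Alternating F → ∀ u i R → (∀ j → R i j ≡ u j) → F (u ∷ R) ≡ 0ℚ
vanish-repeated {suc k} alt u i R =
  vanish-anywhere (∷-alternating alt u) {u} (λ A eq → Alternating.alternating alt here (λ j → sym (eq j))) i R

-- Each row is its first entry times `e₀` plus a row with first entry 0. Linearity and `vanish-e₀`
-- therefore allow that entry to be replaced by 0, one row at a time from the last to the first; in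
-- `go t` the rows from `t` on are already cleared.
clear-column : {F : Mat k (suc n) → ℚ} → Alternating F →
               (∀ i A → (∀ j → A i j ≡ e₀ j) → F A ≡ 0ℚ) →
               (∀ A → F (pad A) ≡ 0ℚ) → ∀ A → F A ≡ 0ℚ
clear-column {k} {n} {F} alt vanish-e₀ vanish-pad A = go k A λ i k≤i → ⊥-elim (ℕₚ.<⇒≱ (Finₚ.toℕ<n i) k≤i)
  where
  open Alternating alt
  go : ∀ t A → (∀ i → t ≤ toℕ i → A i zero ≡ 0ℚ) → F A ≡ 0ℚ
  go zero A A≡0 = trans (respects λ { i zero → A≡0 i z≤n ; i (suc j) → refl }) (vanish-pad (λ i j → A i (suc j)))
  go (suc t) A A≡0 with t ℕ.<? k
  ... | no t≮k = go t A λ i t≤i → ⊥-elim (t≮k (ℕₚ.≤-<-trans t≤i (Finₚ.toℕ<n i)))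
  ... | yes t<k = begin
    F A                       ≡⟨ linear i (A i zero) {E} {Z} {A} AE AZ Ai ⟩
    A i zero * F E + F Z      ≡⟨ cong₂ (λ x y → A i zero * x + y) FE≡0 FZ≡0 ⟩
    A i zero * 0ℚ + 0ℚ        ≡⟨ solve 1 (λ x → x :* con 0ℚ :+ con 0ℚ := con 0ℚ) refl (A i zero) ⟩
    0ℚ                        ∎
    where
    open ≡-Reasoning
    i = fromℕ< t<k
    z : Fin (suc n) → ℚ
    z = 0ℚ ∷ λ j → A i (suc j)
    E = A [ i ≔ e₀ ]
    Z = A [ i ≔ z ]
    AE : AgreeOff i A E
    AE r r≢ j = cong (λ f → f j) (sym (updateAt-minimal r i A r≢))
    AZ : AgreeOff i A Z
    AZ r r≢ j = cong (λ f → f j) (sym (updateAt-minimal r i A r≢))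
    Ai : ∀ j → A i j ≡ A i zero * E i j + Z i j
    Ai j rewrite updateAt-updates i {f = const e₀} A | updateAt-updates i {f = const z} A = lemma j
      where
      lemma : ∀ j → A i j ≡ A i zero * e₀ j + z j
      lemma zero    = solve 1 (λ x → x := x :* con 1ℚ :+ con 0ℚ) refl (A i zero)
      lemma (suc j) = solve 2 (λ x y → y := x :* con 0ℚ :+ y) refl (A i zero) (A i (suc j))
    FE≡0 : F E ≡ 0ℚ
    FE≡0 = vanish-e₀ i E λ j → cong (λ f → f j) (updateAt-updates i A)
    Z≡0 : ∀ r → t ≤ toℕ r → Z r zero ≡ 0ℚ
    Z≡0 r t≤r with r Finₚ.≟ i
    ... | yes refl = cong (λ f → f zero) (updateAt-updates i A)
    ... | no r≢i = trans (cong (λ f → f zero) (updateAt-minimal r i A r≢i)) (A≡0 r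
      (ℕₚ.≤∧≢⇒< t≤r λ t≡r → r≢i (Finₚ.toℕ-injective (trans (sym t≡r) (sym (Finₚ.toℕ-fromℕ< t<k))))))
    FZ≡0 : F Z ≡ 0ℚ
    FZ≡0 = go t Z Z≡0

-- Two clearings of the first column. The outer one leaves the case of some row equal to `e₀`, which
-- `vanish-anywhere` moves to the top; the inner one clears below it, where a further row `e₀` would
-- repeat the top one.
vanish-step : {F : Mat (suc k) (suc n) → ℚ} → Alternating F →
              (∀ R → F (e₀ ∷ pad R) ≡ 0ℚ) → (∀ A → F (pad A) ≡ 0ℚ) → ∀ A → F A ≡ 0ℚ
vanish-step {F = F} alt vanish-∷ = clear-column alt (vanish-anywhere alt {e₀} vanish₀)
  where
  vanish₀ : ∀ A → (∀ j → A zero j ≡ e₀ j) → F A ≡ 0ℚ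
  vanish₀ A eq = trans (Alternating.respects alt λ { zero j → eq j ; (suc i) j → refl })
    (clear-column (∷-alternating alt e₀) (vanish-repeated alt e₀) vanish-∷ (λ i → A (suc i)))

-- Each step loses one column and at most one row, so rows outnumber columns throughout; rows of
-- length zero are finally zero rows.
vanish-overdetermined : n < k → {F : Mat k n → ℚ} → Alternating F → ∀ A → F A ≡ 0ℚ
vanish-overdetermined {zero}  {suc k} _         alt A = vanish-zero-row alt zero λ ()
vanish-overdetermined {suc n} {suc k} (s≤s n<k) alt =
  vanish-step alt (vanish-overdetermined n<k (pad-alternating (∷-alternating alt e₀)))
                  (vanish-overdetermined (ℕₚ.m<n⇒m<1+n n<k) (pad-alternating alt))

-- In the padded case n+1 rows live in n columns and the form vanishes. Only the branch with `e₀` on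
-- top survives, and there the identity restricts to the smaller identity.
vanish-square : {F : Mat n n → ℚ} → Alternating F → F I ≡ 0ℚ → ∀ A → F A ≡ 0ℚ
vanish-square {zero}  alt FI≡0 A = trans (Alternating.respects alt λ ()) FI≡0
vanish-square {suc n} alt FI≡0 =
  vanish-step alt
    (vanish-square (pad-alternating (∷-alternating alt e₀))
      (trans (Alternating.respects alt
               λ { zero zero → refl ; zero (suc j) → refl ; (suc i) zero → refl ; (suc i) (suc j) → refl }) FI≡0))
    (vanish-overdetermined (ℕₚ.n<1+n n) (pad-alternating alt))

-- Matrix products and multiplicativity of the determinant

infixl 7 _⊗_
_⊗_ : Mat k n → ∀ {l} → Mat n l → Mat k l
(A ⊗ B) i j = sum (λ l → A i l * B l j)

infix 8 _ᵀ
_ᵀ : Mat k n → Mat n k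
(A ᵀ) i j = A j i

ᵀ-⊗ : ∀ {l} (A : Mat k n) (B : Mat n l) → (A ⊗ B) ᵀ ≐ B ᵀ ⊗ A ᵀ
ᵀ-⊗ A B i j = sum-cong-≗ λ l → ℚₚ.*-comm (A j l) (B l i)

I-⊗ : ∀ {l} (B : Mat n l) → I ⊗ B ≐ B
I-⊗ B zero j = trans
  (cong₂ _+_ (ℚₚ.*-identityˡ (B zero j)) (sum-zero λ l → ℚₚ.*-zeroˡ (B (suc l) j)))
  (ℚₚ.+-identityʳ (B zero j))
I-⊗ B (suc i) j = trans
  (cong₂ _+_ (ℚₚ.*-zeroˡ (B zero j)) (I-⊗ (λ l → B (suc l)) i j))
  (ℚₚ.+-identityˡ (B (suc i) j))

det-zero-row : ∀ i {A : Mat n n} → (∀ j → A i j ≡ 0ℚ) → det A ≡ 0ℚ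
det-zero-row i = vanish-zero-row (det-isAlternating _) i

det-cleared-column : (A : Mat (suc n) (suc n)) → (∀ i → A (suc i) zero ≡ 0ℚ) →
                     det A ≡ A zero zero * det (minor A zero)
det-cleared-column {n} A A≡0 = begin
  1ℚ * A zero zero * D + sum (λ r → sgn (suc r) * A (suc r) zero * det (minor A (suc r)))
    ≡⟨ cong (λ z → 1ℚ * A zero zero * D + z) (sum-zero term) ⟩
  1ℚ * A zero zero * D + 0ℚ
    ≡⟨ solve 2 (λ a D → con 1ℚ :* a :* D :+ con 0ℚ := a :* D) refl (A zero zero) D ⟩
  A zero zero * D ∎
  where
  open ≡-Reasoning
  D = det (minor A zero)
  term : ∀ r → sgn (suc r) * A (suc r) zero * det (minor A (suc r)) ≡ 0ℚ
  term r rewrite A≡0 r = solve 2 (λ s D → s :* con 0ℚ :* D := con 0ℚ) refl (sgn (suc r)) (det (minor A (suc r)))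

det-cleared-row : (A : Mat (suc n) (suc n)) → (∀ j → A zero (suc j) ≡ 0ℚ) →
                  det A ≡ A zero zero * det (minor A zero)
det-cleared-row {n} A A≡0 = begin
  1ℚ * A zero zero * D + sum (λ r → sgn (suc r) * A (suc r) zero * det (minor A (suc r)))
    ≡⟨ cong (λ z → 1ℚ * A zero zero * D + z) (sum-zero term) ⟩
  1ℚ * A zero zero * D + 0ℚ
    ≡⟨ solve 2 (λ a D → con 1ℚ :* a :* D :+ con 0ℚ := a :* D) refl (A zero zero) D ⟩
  A zero zero * D ∎
  where
  open ≡-Reasoning
  D = det (minor A zero)
  -- Deleting a row other than the first leaves the zero part of the first row as a whole row of the
  -- minor.
  minor≡0 : ∀ {n} (A : Mat (suc n) (suc n)) → (∀ j → A zero (suc j) ≡ 0ℚ) → ∀ r → det (minor A (suc r)) ≡ 0ℚ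
  minor≡0 {suc n} A A≡0 r = det-zero-row zero {minor A (suc r)} A≡0
  term : ∀ r → sgn (suc r) * A (suc r) zero * det (minor A (suc r)) ≡ 0ℚ
  term r rewrite minor≡0 A A≡0 r = ℚₚ.*-zeroʳ (sgn (suc r) * A (suc r) zero)

det-lower : (A : Mat n n) → (∀ i j → toℕ i < toℕ j → A i j ≡ 0ℚ) → det A ≡ prod (λ i → A i i)
det-lower {zero}  A A≡0 = refl
det-lower {suc n} A A≡0 = trans (det-cleared-row A λ j → A≡0 zero (suc j) (s≤s z≤n))
  (cong (A zero zero *_) (det-lower (minor A zero) λ i j i<j → A≡0 (suc i) (suc j) (s≤s i<j)))

det-upper : (A : Mat n n) → (∀ i j → toℕ j < toℕ i → A i j ≡ 0ℚ) → det A ≡ prod (λ i → A i i)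
det-upper {zero}  A A≡0 = refl
det-upper {suc n} A A≡0 = trans (det-cleared-column A λ i → A≡0 (suc i) zero (s≤s z≤n))
  (cong (A zero zero *_) (det-upper (minor A zero) λ i j j<i → A≡0 (suc i) (suc j) (s≤s j<i)))

det-I : ∀ n → det (I {n}) ≡ 1ℚ
det-I zero    = refl
det-I (suc n) = trans (det-cleared-column {n} I λ _ → refl) (trans (ℚₚ.*-identityˡ (det (I {n}))) (det-I n))

-- For fixed `B`, the defect det (X B) - det X det B is an alternating form in the rows of X, and it
-- is zero at the identity.
det-⊗ : (A B : Mat n n) → det (A ⊗ B) ≡ det A * det B
det-⊗ {n} A B = begin
  det (A ⊗ B)                     ≡⟨ solve 2 (λ x y → x := (x :- y) :+ y) refl (det (A ⊗ B)) (det A * det B) ⟩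
  F A + det A * det B             ≡⟨ cong (_+ det A * det B) (vanish-square F-alternating FI≡0 A) ⟩
  0ℚ + det A * det B              ≡⟨ ℚₚ.+-identityˡ (det A * det B) ⟩
  det A * det B                   ∎
  where
  open ≡-Reasoning
  F : Mat n n → ℚ
  F X = det (X ⊗ B) - det X * det B
  ⊗-row : ∀ {X Y : Mat n n} {i} → (∀ l → X i l ≡ Y i l) → ∀ j → (X ⊗ B) i j ≡ (Y ⊗ B) i j
  ⊗-row eq j = sum-cong-≗ λ l → cong (_* B l j) (eq l)
  F-linear : ∀ i x {X Y Z : Mat n n} → AgreeOff i Z X → AgreeOff i Z Y →
             (∀ j → Z i j ≡ x * X i j + Y i j) → F Z ≡ x * F X + F Y
  F-linear i x {X} {Y} {Z} ZX ZY eq = begin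
    det (Z ⊗ B) - det Z * det B
      ≡⟨ cong₂ (λ y z → y - z * det B) ⊗-linear (det-linear i x ZX ZY eq) ⟩
    (x * det (X ⊗ B) + det (Y ⊗ B)) - (x * det X + det Y) * det B
      ≡⟨ solve 6 (λ x p q a b D → (x :* p :+ q) :- (x :* a :+ b) :* D := x :* (p :- a :* D) :+ (q :- b :* D)) refl
           x (det (X ⊗ B)) (det (Y ⊗ B)) (det X) (det Y) (det B) ⟩
    x * F X + F Y ∎
    where
    ⊗-linear : det (Z ⊗ B) ≡ x * det (X ⊗ B) + det (Y ⊗ B)
    ⊗-linear = det-linear i x
      (λ r r≢i → ⊗-row {Z} {X} (ZX r r≢i)) (λ r r≢i → ⊗-row {Z} {Y} (ZY r r≢i))
      (λ j → sum-linear x λ l → trans (cong (_* B l j) (eq l))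
        (solve 4 (λ x a b c → (x :* a :+ b) :* c := x :* (a :* c) :+ b :* c) refl
          x (X i l) (Y i l) (B l j)))
  F-alternates : ∀ {i i′} → Next i i′ → ∀ {X} → (∀ j → X i j ≡ X i′ j) → F X ≡ 0ℚ
  F-alternates {i} {i′} nx {X} eq
    rewrite det-alternates nx {X} eq
          | det-alternates nx {X ⊗ B} (λ j → sum-cong-≗ λ l → cong (_* B l j) (eq l))
    = solve 1 (λ D → con 0ℚ :- con 0ℚ :* D := con 0ℚ) refl (det B)
  F-alternating : Alternating F
  F-alternating = record
    { respects    = λ {X} {Y} eq → cong₂ (λ x y → x - y * det B)
                      (det-cong λ i → ⊗-row {X} {Y} (eq i)) (det-cong eq)
    ; linear      = F-linear
    ; alternating = F-alternates
    }
  FI≡0 : F I ≡ 0ℚ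
  FI≡0 = begin
    det (I ⊗ B) - det (I {n}) * det B ≡⟨ cong₂ (λ x y → x - y * det B) (det-cong (I-⊗ B)) (det-I n) ⟩
    det B - 1ℚ * det B                ≡⟨ solve 1 (λ D → D :- con 1ℚ :* D := con 0ℚ) refl (det B) ⟩
    0ℚ                                ∎

-- This plays the role of (det A)²; the product is what the Gram matrix A Aᵀ produces,
-- so invariance of det under transposition is never needed.
detSq : Mat n n → ℚ
detSq A = det A * det (A ᵀ)

detSq-cong : {A B : Mat n n} → A ≐ B → detSq A ≡ detSq B
detSq-cong eq = cong₂ _*_ (det-cong eq) (det-cong λ i j → eq j i)

detSq-⊗ : (A B : Mat n n) → detSq (A ⊗ B) ≡ detSq A * detSq B
detSq-⊗ A B = trans
  (cong₂ _*_ (det-⊗ A B) (trans (det-cong (ᵀ-⊗ A B)) (det-⊗ (B ᵀ) (A ᵀ))))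
  (solve 4 (λ a b a′ b′ → a :* b :* (b′ :* a′) := a :* a′ :* (b :* b′)) refl
    (det A) (det B) (det (A ᵀ)) (det (B ᵀ)))

detSq-lower : (A : Mat n n) → (∀ i j → toℕ i < toℕ j → A i j ≡ 0ℚ) →
              detSq A ≡ prod (λ i → A i i) * prod (λ i → A i i)
detSq-lower A A≡0 = cong₂ _*_ (det-lower A A≡0) (det-upper (A ᵀ) λ i j → A≡0 j i)

detSq-cleared-column : (A : Mat (suc n) (suc n)) → (∀ i → A (suc i) zero ≡ 0ℚ) →
                       detSq A ≡ A zero zero * A zero zero * detSq (minor A zero)
detSq-cleared-column A A≡0 = trans
  (cong₂ _*_ (det-cleared-column A A≡0) (det-cleared-row (A ᵀ) A≡0))
  (solve 3 (λ a D E → a :* D :* (a :* E) := a :* a :* (D :* E)) refl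
    (A zero zero) (det (minor A zero)) (det (minor (A ᵀ) zero)))

detSq-orthogonal : (A : Mat n n) → (∀ i j → i ≢ j → (A ⊗ A ᵀ) i j ≡ 0ℚ) →
                   detSq A ≡ prod (λ i → (A ⊗ A ᵀ) i i)
detSq-orthogonal A ⊥ = trans (sym (det-⊗ A (A ᵀ)))
  (det-lower (A ⊗ A ᵀ) λ i j i<j → ⊥ i j λ i≡j → ℕₚ.<⇒≢ i<j (cong toℕ i≡j))

-- Integers inside ℚ

ℤ→ℚ-mkℚ : ∀ z → ℤ→ℚ z ≡ mkℚ z 0 (coprime-sym (1-coprimeTo ℤ.∣ z ∣))
ℤ→ℚ-mkℚ (+ n)      = ℚₚ.normalize-coprime (coprime-sym (1-coprimeTo n))
ℤ→ℚ-mkℚ (-[1+ n ]) = cong -_ (ℚₚ.normalize-coprime (coprime-sym (1-coprimeTo (suc n))))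

toℚᵘ-ℤ→ℚ : ∀ z → ℚ.toℚᵘ (ℤ→ℚ z) ≡ ℚᵘ.mkℚᵘ z 0
toℚᵘ-ℤ→ℚ z = cong ℚ.toℚᵘ (ℤ→ℚ-mkℚ z)

ℤ→ℚ-homo-+ : ∀ x y → ℤ→ℚ (x ℤ.+ y) ≡ ℤ→ℚ x + ℤ→ℚ y
ℤ→ℚ-homo-+ x y = ℚₚ.toℚᵘ-injective (ℚᵘₚ.≃-trans (ℚᵘₚ.≃-reflexive (toℚᵘ-ℤ→ℚ (x ℤ.+ y)))
  (ℚᵘₚ.≃-trans eq (ℚᵘₚ.≃-sym (ℚₚ.toℚᵘ-homo-+ (ℤ→ℚ x) (ℤ→ℚ y)))))
  where
  eq : ℚᵘ.mkℚᵘ (x ℤ.+ y) 0 ℚᵘ.≃ ℚ.toℚᵘ (ℤ→ℚ x) ℚᵘ.+ ℚ.toℚᵘ (ℤ→ℚ y)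
  eq rewrite toℚᵘ-ℤ→ℚ x | toℚᵘ-ℤ→ℚ y = ℚᵘ.*≡* (cong (ℤ._* + 1)
    (sym (cong₂ ℤ._+_ (ℤₚ.*-identityʳ x) (ℤₚ.*-identityʳ y))))

ℤ→ℚ-homo-* : ∀ x y → ℤ→ℚ (x ℤ.* y) ≡ ℤ→ℚ x * ℤ→ℚ y
ℤ→ℚ-homo-* x y = ℚₚ.toℚᵘ-injective (ℚᵘₚ.≃-trans (ℚᵘₚ.≃-reflexive (toℚᵘ-ℤ→ℚ (x ℤ.* y)))
  (ℚᵘₚ.≃-trans eq (ℚᵘₚ.≃-sym (ℚₚ.toℚᵘ-homo-* (ℤ→ℚ x) (ℤ→ℚ y)))))
  where
  eq : ℚᵘ.mkℚᵘ (x ℤ.* y) 0 ℚᵘ.≃ ℚ.toℚᵘ (ℤ→ℚ x) ℚᵘ.* ℚ.toℚᵘ (ℤ→ℚ y)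
  eq rewrite toℚᵘ-ℤ→ℚ x | toℚᵘ-ℤ→ℚ y = ℚᵘ.*≡* refl

ℤ→ℚ-homo-neg : ∀ x → ℤ→ℚ (ℤ.- x) ≡ - ℤ→ℚ x
ℤ→ℚ-homo-neg (+ zero)   = refl
ℤ→ℚ-homo-neg (+ suc n)  = refl
ℤ→ℚ-homo-neg (-[1+ n ]) = sym (trans (cong (-_ ∘ -_) (ℚₚ.normalize-coprime c)) (sym (ℚₚ.normalize-coprime c)))
  where c = coprime-sym (1-coprimeTo (suc n))

ℤ→ℚ-injective : ∀ {x y} → ℤ→ℚ x ≡ ℤ→ℚ y → x ≡ y
ℤ→ℚ-injective {x} {y} eq = cong ℚ.ℚ.numerator (trans (sym (ℤ→ℚ-mkℚ x)) (trans eq (ℤ→ℚ-mkℚ y)))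

Integral : ℚ → Set
Integral x = ∃ λ z → x ≡ ℤ→ℚ z

integral-+ : ∀ {x y} → Integral x → Integral y → Integral (x + y)
integral-+ (a , refl) (b , refl) = a ℤ.+ b , sym (ℤ→ℚ-homo-+ a b)

integral-* : ∀ {x y} → Integral x → Integral y → Integral (x * y)
integral-* (a , refl) (b , refl) = a ℤ.* b , sym (ℤ→ℚ-homo-* a b)

integral-sum : {f : Fin n → ℚ} → (∀ i → Integral (f i)) → Integral (sum f)
integral-sum {zero}  int = + 0 , refl
integral-sum {suc n} int = integral-+ (int zero) (integral-sum (λ i → int (suc i)))

integral-sgn : (i : Fin n) → Integral (sgn i)
integral-sgn zero    = + 1 , refl
integral-sgn (suc i) with integral-sgn i
... | z , eq = ℤ.- z , trans (cong -_ eq) (sym (ℤ→ℚ-homo-neg z))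

integral-det : (A : Mat n n) → (∀ i j → Integral (A i j)) → Integral (det A)
integral-det {zero}  A int = + 1 , refl
integral-det {suc n} A int = integral-sum λ r →
  integral-* (integral-* (integral-sgn r) (int r zero)) (integral-det (minor A r) λ i j → int _ _)

integral-pos⇒≥1 : ∀ {x} → Integral x → 0ℚ ℚ.< x → 1ℚ ℚ.≤ x
integral-pos⇒≥1 (z , refl) 0<z rewrite ℤ→ℚ-mkℚ z with z
... | + zero     = ⊥-elim (ℚₚ.<-irrefl refl 0<z)
... | + (suc n)  = *≤* (ℤ.+≤+ (s≤s z≤n))
... | -[1+ n ] with 0<z
... | *<* ()

-- Finite sums over ℕ

ΣQ-cong : ∀ n {f g : ℕ → ℚ} → (∀ i → i < n → f i ≡ g i) → ΣQ n f ≡ ΣQ n g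
ΣQ-cong zero    eq = refl
ΣQ-cong (suc n) eq = cong₂ _+_ (ΣQ-cong n λ i i<n → eq i (ℕₚ.m<n⇒m<1+n i<n)) (eq n (ℕₚ.n<1+n n))

ΣQ-zero : ∀ n {f : ℕ → ℚ} → (∀ i → i < n → f i ≡ 0ℚ) → ΣQ n f ≡ 0ℚ
ΣQ-zero zero    eq = refl
ΣQ-zero (suc n) eq = cong₂ _+_ (ΣQ-zero n λ i i<n → eq i (ℕₚ.m<n⇒m<1+n i<n)) (eq n (ℕₚ.n<1+n n))

ΣQ-+ : ∀ n (f g : ℕ → ℚ) → ΣQ n (λ i → f i + g i) ≡ ΣQ n f + ΣQ n g
ΣQ-+ zero    f g = refl
ΣQ-+ (suc n) f g = trans (cong (_+ (f n + g n)) (ΣQ-+ n f g))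
  (solve 4 (λ a b c d → a :+ b :+ (c :+ d) := a :+ c :+ (b :+ d)) refl (ΣQ n f) (ΣQ n g) (f n) (g n))

ΣQ-*ˡ : ∀ n x (f : ℕ → ℚ) → ΣQ n (λ i → x * f i) ≡ x * ΣQ n f
ΣQ-*ˡ zero    x f = sym (ℚₚ.*-zeroʳ x)
ΣQ-*ˡ (suc n) x f = trans (cong (_+ x * f n) (ΣQ-*ˡ n x f)) (sym (ℚₚ.*-distribˡ-+ x (ΣQ n f) (f n)))

ΣQ-comm : ∀ m n (f : ℕ → ℕ → ℚ) → ΣQ m (λ i → ΣQ n (f i)) ≡ ΣQ n (λ j → ΣQ m (λ i → f i j))
ΣQ-comm zero    n f = sym (ΣQ-zero n λ _ _ → refl)
ΣQ-comm (suc m) n f = trans (cong (_+ ΣQ n (f m)) (ΣQ-comm m n f))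
  (sym (ΣQ-+ n (λ j → ΣQ m (λ i → f i j)) (f m)))

ΣQ-single : ∀ n {f : ℕ → ℚ} l → l < n → (∀ i → i < n → i ≢ l → f i ≡ 0ℚ) → ΣQ n f ≡ f l
ΣQ-single (suc n) {f} l l<1+n rest with l ℕ.≟ n
... | yes refl = trans (cong (_+ f n) (ΣQ-zero n λ i i<n → rest i (ℕₚ.m<n⇒m<1+n i<n) (ℕₚ.<⇒≢ i<n)))
                       (ℚₚ.+-identityˡ (f n))
... | no l≢n = trans (cong₂ _+_
    (ΣQ-single n l (ℕₚ.≤∧≢⇒< (ℕₚ.≤-pred l<1+n) l≢n) λ i i<n → rest i (ℕₚ.m<n⇒m<1+n i<n))
    (rest n (ℕₚ.n<1+n n) (l≢n ∘ sym)))
  (ℚₚ.+-identityʳ (f l))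

ΣQ-nonNeg : ∀ n {f : ℕ → ℚ} → (∀ i → 0ℚ ℚ.≤ f i) → 0ℚ ℚ.≤ ΣQ n f
ΣQ-nonNeg zero    f≥0 = ℚₚ.≤-refl
ΣQ-nonNeg (suc n) f≥0 = ℚₚ.+-mono-≤ (ΣQ-nonNeg n f≥0) (f≥0 n)

nonNeg-+-zero : ∀ {x y} → 0ℚ ℚ.≤ x → 0ℚ ℚ.≤ y → x + y ≡ 0ℚ → x ≡ 0ℚ × y ≡ 0ℚ
nonNeg-+-zero {x} {y} x≥0 y≥0 eq = ℚₚ.≤-antisym x≤0 x≥0 , ℚₚ.≤-antisym y≤0 y≥0
  where
  x≤0 : x ℚ.≤ 0ℚ
  x≤0 = subst₂ ℚ._≤_ (ℚₚ.+-identityʳ x) eq (ℚₚ.+-monoʳ-≤ x y≥0)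
  y≤0 : y ℚ.≤ 0ℚ
  y≤0 = subst₂ ℚ._≤_ (ℚₚ.+-identityˡ y) eq (ℚₚ.+-monoˡ-≤ y x≥0)

ΣQ-nonNeg-zero : ∀ n {f : ℕ → ℚ} → (∀ i → 0ℚ ℚ.≤ f i) → ΣQ n f ≡ 0ℚ → ∀ i → i < n → f i ≡ 0ℚ
ΣQ-nonNeg-zero (suc n) {f} f≥0 eq i i<1+n with nonNeg-+-zero (ΣQ-nonNeg n f≥0) (f≥0 n) eq | i ℕ.≟ n
... | _ , fn≡0 | yes refl = fn≡0
... | Σ≡0 , _  | no i≢n   = ΣQ-nonNeg-zero n f≥0 Σ≡0 i (ℕₚ.≤∧≢⇒< (ℕₚ.≤-pred i<1+n) i≢n)

-- Order and division in ℚ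

*-mono-≤ : ∀ {a b c e} → 0ℚ ℚ.≤ a → a ℚ.≤ b → 0ℚ ℚ.≤ c → c ℚ.≤ e → a * c ℚ.≤ b * e
*-mono-≤ {a} {b} {c} {e} a≥0 a≤b c≥0 c≤e = ℚₚ.≤-trans
  (ℚₚ.*-monoʳ-≤-nonNeg c {{ℚ.nonNegative c≥0}} a≤b)
  (ℚₚ.*-monoˡ-≤-nonNeg b {{ℚ.nonNegative (ℚₚ.≤-trans a≥0 a≤b)}} c≤e)

*-nonNeg : ∀ {a b} → 0ℚ ℚ.≤ a → 0ℚ ℚ.≤ b → 0ℚ ℚ.≤ a * b
*-nonNeg {a} {b} a≥0 b≥0 = subst (ℚ._≤ a * b) (ℚₚ.*-zeroʳ a) (ℚₚ.*-monoˡ-≤-nonNeg a {{ℚ.nonNegative a≥0}} b≥0)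

square-abs : ∀ x → x * x ≡ ℚ.∣ x ∣ * ℚ.∣ x ∣
square-abs x with ℚₚ.∣p∣≡p∨∣p∣≡-p x
... | inj₁ eq rewrite eq = refl
... | inj₂ eq rewrite eq = solve 1 (λ x → x :* x := (:- x) :* (:- x)) refl x

square-nonNeg : ∀ x → 0ℚ ℚ.≤ x * x
square-nonNeg x = subst (0ℚ ℚ.≤_) (sym (square-abs x)) (*-nonNeg (ℚₚ.0≤∣p∣ x) (ℚₚ.0≤∣p∣ x))

*-cancel-0 : ∀ {x y} → x ≢ 0ℚ → x * y ≡ 0ℚ → y ≡ 0ℚ
*-cancel-0 {x} {y} x≢0 eq = begin
  y                    ≡⟨ ℚₚ.*-identityˡ y ⟨
  1ℚ * y               ≡⟨ cong (_* y) (ℚₚ.*-inverseˡ x) ⟨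
  ℚ.1/ x * x * y       ≡⟨ ℚₚ.*-assoc (ℚ.1/ x) x y ⟩
  ℚ.1/ x * (x * y)     ≡⟨ cong (ℚ.1/ x *_) eq ⟩
  ℚ.1/ x * 0ℚ          ≡⟨ ℚₚ.*-zeroʳ (ℚ.1/ x) ⟩
  0ℚ                   ∎
  where
  open ≡-Reasoning
  instance _ = ℚ.≢-nonZero x≢0

square-zero : ∀ {x} → x * x ≡ 0ℚ → x ≡ 0ℚ
square-zero {x} eq with x ℚ.≟ 0ℚ
... | yes x≡0 = x≡0
... | no x≢0  = *-cancel-0 x≢0 eq

÷₀-* : ∀ x y → (y ≡ 0ℚ → x ≡ 0ℚ) → (x ÷₀ y) * y ≡ x
÷₀-* x y x≡0 with y ℚ.≟ 0ℚ
... | yes y≡0 = trans (ℚₚ.*-zeroˡ y) (sym (x≡0 y≡0))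
... | no y≢0 = begin
  x * ℚ.1/ y * y       ≡⟨ ℚₚ.*-assoc x (ℚ.1/ y) y ⟩
  x * (ℚ.1/ y * y)     ≡⟨ cong (x *_) (ℚₚ.*-inverseˡ y) ⟩
  x * 1ℚ               ≡⟨ ℚₚ.*-identityʳ x ⟩
  x                    ∎
  where
  open ≡-Reasoning
  instance _ = ℚ.≢-nonZero y≢0

-- Gram–Schmidt orthogonalisation

dot-comm : ∀ n u v → dot n u v ≡ dot n v u
dot-comm n u v = ΣQ-cong n λ j _ → ℚₚ.*-comm (u j) (v j)

dot-self-nonNeg : ∀ n u → 0ℚ ℚ.≤ dot n u u
dot-self-nonNeg n u = ΣQ-nonNeg n λ j → square-nonNeg (u j)

dot-self-zero : ∀ n u v → dot n u u ≡ 0ℚ → dot n v u ≡ 0ℚ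
dot-self-zero n u v eq = ΣQ-zero n λ j j<n → trans
  (cong (v j *_) (square-zero (ΣQ-nonNeg-zero n (λ i → square-nonNeg (u i)) eq j j<n)))
  (ℚₚ.*-zeroʳ (v j))

dot-congˡ : ∀ n {u u′} v → (∀ j → j < n → u j ≡ u′ j) → dot n u v ≡ dot n u′ v
dot-congˡ n v eq = ΣQ-cong n λ j j<n → cong (_* v j) (eq j j<n)

dot-+ˡ : ∀ n u v w → dot n (λ j → u j + v j) w ≡ dot n u w + dot n v w
dot-+ˡ n u v w = trans (ΣQ-cong n λ j _ → ℚₚ.*-distribʳ-+ (w j) (u j) (v j))
  (ΣQ-+ n (λ j → u j * w j) (λ j → v j * w j))

dot-*ˡ : ∀ n x u w → dot n (λ j → x * u j) w ≡ x * dot n u w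
dot-*ˡ n x u w = trans (ΣQ-cong n λ j _ → ℚₚ.*-assoc x (u j) (w j)) (ΣQ-*ˡ n x (λ j → u j * w j))

dot-Σˡ : ∀ n k (c : ℕ → ℚ) (v : ℕ → Vecℚ) w →
         dot n (λ j → ΣQ k (λ l → c l * v l j)) w ≡ ΣQ k (λ l → c l * dot n (v l) w)
dot-Σˡ n k c v w = begin
  ΣQ n (λ j → ΣQ k (λ l → c l * v l j) * w j)
    ≡⟨ ΣQ-cong n (λ j _ → trans (ℚₚ.*-comm (ΣQ k (λ l → c l * v l j)) (w j))
         (sym (ΣQ-*ˡ k (w j) (λ l → c l * v l j)))) ⟩
  ΣQ n (λ j → ΣQ k (λ l → w j * (c l * v l j)))
    ≡⟨ ΣQ-comm n k (λ j l → w j * (c l * v l j)) ⟩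
  ΣQ k (λ l → ΣQ n (λ j → w j * (c l * v l j)))
    ≡⟨ ΣQ-cong k (λ l _ → trans
         (ΣQ-cong n λ j _ → solve 3 (λ w c v → w :* (c :* v) := c :* v :* w) refl (w j) (c l) (v l j))
         (dot-*ˡ n (c l) (v l) w)) ⟩
  ΣQ k (λ l → c l * dot n (v l) w) ∎
  where open ≡-Reasoning

module GramSchmidt (n : ℕ) (b : ℕ → Vecℚ) where
  private
    g : ℕ → Vecℚ
    g = gs n b

  sqnorm : ℕ → ℚ
  sqnorm i = dot n (g i) (g i)

  gsUpTo-suc : ∀ {k l} → l < k → gsUpTo n b (suc k) l ≡ gsUpTo n b k l
  gsUpTo-suc {k} {l} l<k with l ℕ.<? k
  ... | yes _  = refl
  ... | no l≮k = ⊥-elim (l≮k l<k)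

  gsUpTo≡gs : ∀ {k l} → l < k → gsUpTo n b k l ≡ g l
  gsUpTo≡gs {suc k} {l} l<1+k with l ℕ.≟ k
  ... | yes refl = refl
  ... | no l≢k   = trans (gsUpTo-suc l<k) (gsUpTo≡gs l<k)
    where l<k = ℕₚ.≤∧≢⇒< (ℕₚ.≤-pred l<1+k) l≢k

  -- `gsUpTo` freezes each vector once it is built, so the vectors used at stage `k` are the final
  -- ones and the textbook recursion holds.
  gs-def : ∀ k j → g k j ≡ b k j - ΣQ k (λ l → μ n b k l * g l j)
  gs-def k j with k ℕ.<? k
  ... | yes k<k = ⊥-elim (ℕₚ.<-irrefl refl k<k)
  ... | no _    = cong (λ z → b k j - z) (ΣQ-cong k λ l l<k →
    cong (λ h → (dot n (b k) h ÷₀ dot n h h) * h j) (gsUpTo≡gs l<k))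

  decomposition : ∀ k j → b k j ≡ g k j + ΣQ k (λ l → μ n b k l * g l j)
  decomposition k j = begin
    b k j               ≡⟨ solve 2 (λ x y → x := x :- y :+ y) refl (b k j) S ⟩
    b k j - S + S       ≡⟨ cong (_+ S) (gs-def k j) ⟨
    g k j + S           ∎
    where
    open ≡-Reasoning
    S = ΣQ k (λ l → μ n b k l * g l j)

  dot-decomposition : ∀ k w → dot n (b k) w ≡ dot n (g k) w + ΣQ k (λ l → μ n b k l * dot n (g l) w)
  dot-decomposition k w = begin
    dot n (b k) w
      ≡⟨ dot-congˡ n w (λ j _ → decomposition k j) ⟩
    dot n (λ j → g k j + ΣQ k (λ l → μ n b k l * g l j)) w
      ≡⟨ dot-+ˡ n (g k) (λ j → ΣQ k (λ l → μ n b k l * g l j)) w ⟩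
    dot n (g k) w + dot n (λ j → ΣQ k (λ l → μ n b k l * g l j)) w
      ≡⟨ cong (λ z → dot n (g k) w + z) (dot-Σˡ n k (μ n b k) g w) ⟩
    dot n (g k) w + ΣQ k (λ l → μ n b k l * dot n (g l) w) ∎
    where open ≡-Reasoning

  -- If `g l` is zero, its inner product with b_k vanishes as well, which agrees with the default
  -- value of `÷₀`.
  μ-* : ∀ k l → μ n b k l * sqnorm l ≡ dot n (b k) (g l)
  μ-* k l = ÷₀-* (dot n (b k) (g l)) (sqnorm l) (dot-self-zero n (g l) (b k))

  private
    +-cancel-self : ∀ {x y} → y ≡ x + y → x ≡ 0ℚ
    +-cancel-self {x} {y} eq = begin
      x          ≡⟨ solve 2 (λ x y → x := x :+ y :- y) refl x y ⟩
      x + y - y  ≡⟨ cong (_- y) eq ⟨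
      y - y      ≡⟨ ℚₚ.+-inverseʳ y ⟩
      0ℚ         ∎
      where open ≡-Reasoning

  -- `m` bounds both indices and drives a strong induction. When b_k is paired with g_l, the
  -- induction hypothesis leaves only the summand with index l, and that summand is b_k·g_l itself;
  -- hence g_k·g_l must be 0.
  orthogonal-< : ∀ m k l → k < m → l < k → dot n (g k) (g l) ≡ 0ℚ
  orthogonal-< (suc m) k l k<1+m l<k = +-cancel-self (begin
    dot n (b k) (g l)
      ≡⟨ dot-decomposition k (g l) ⟩
    dot n (g k) (g l) + ΣQ k (λ l′ → μ n b k l′ * dot n (g l′) (g l))
      ≡⟨ cong (λ z → dot n (g k) (g l) + z) (trans (ΣQ-single k l l<k others) (μ-* k l)) ⟩
    dot n (g k) (g l) + dot n (b k) (g l) ∎)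
    where
    open ≡-Reasoning
    lower : ∀ i → i < k → i < m
    lower i i<k = ℕₚ.<-≤-trans i<k (ℕₚ.≤-pred k<1+m)
    others : ∀ i → i < k → i ≢ l → μ n b k i * dot n (g i) (g l) ≡ 0ℚ
    others i i<k i≢l = trans (cong (μ n b k i *_) gi⊥gl) (ℚₚ.*-zeroʳ (μ n b k i))
      where
      gi⊥gl : dot n (g i) (g l) ≡ 0ℚ
      gi⊥gl with ℕₚ.<-cmp i l
      ... | tri< i<l _ _ = trans (dot-comm n (g i) (g l)) (orthogonal-< m l i (lower l l<k) i<l)
      ... | tri≈ _ i≡l _ = ⊥-elim (i≢l i≡l)
      ... | tri> _ _ l<i = orthogonal-< m i l (lower i i<k) l<i

  orthogonal : ∀ {i j} → i ≢ j → dot n (g i) (g j) ≡ 0ℚ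
  orthogonal {i} {j} i≢j with ℕₚ.<-cmp i j
  ... | tri< i<j _ _ = trans (dot-comm n (g i) (g j)) (orthogonal-< (suc j) j i (ℕₚ.n<1+n j) i<j)
  ... | tri≈ _ i≡j _ = ⊥-elim (i≢j i≡j)
  ... | tri> _ _ j<i = orthogonal-< (suc i) i j (ℕₚ.n<1+n i) j<i

  orthogonal-complement : ∀ w m → (∀ i → i < m → dot n (b i) w ≡ 0ℚ) → ∀ i → i < m → dot n (g i) w ≡ 0ℚ
  orthogonal-complement w (suc m) b⊥w i i<1+m = begin
    dot n (g i) w            ≡⟨ solve 1 (λ x → x := x :+ con 0ℚ) refl (dot n (g i) w) ⟩
    dot n (g i) w + 0ℚ       ≡⟨ cong (λ z → dot n (g i) w + z) (ΣQ-zero i earlier) ⟨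
    dot n (g i) w + ΣQ i (λ l → μ n b i l * dot n (g l) w)
                             ≡⟨ dot-decomposition i w ⟨
    dot n (b i) w            ≡⟨ b⊥w i i<1+m ⟩
    0ℚ                       ∎
    where
    open ≡-Reasoning
    earlier : ∀ l → l < i → μ n b i l * dot n (g l) w ≡ 0ℚ
    earlier l l<i = trans (cong (μ n b i l *_) (orthogonal-complement w m (λ r r<m → b⊥w r (ℕₚ.m<n⇒m<1+n r<m)) l
      (ℕₚ.<-≤-trans l<i (ℕₚ.≤-pred i<1+m)))) (ℚₚ.*-zeroʳ (μ n b i l))

  sqnorm-combination : ∀ x {i j} → i ≢ j →
    dot n (λ l → g i l + x * g j l) (λ l → g i l + x * g j l) ≡ sqnorm i + x * x * sqnorm j
  sqnorm-combination x {i} {j} i≢j = begin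
    dot n v v
      ≡⟨ expand v ⟩
    dot n (g i) v + x * dot n (g j) v
      ≡⟨ cong₂ (λ y z → y + x * z) (trans (dot-comm n (g i) v) (expand (g i))) (trans (dot-comm n (g j) v) (expand (g j))) ⟩
    (sqnorm i + x * dot n (g j) (g i)) + x * (dot n (g i) (g j) + x * sqnorm j)
      ≡⟨ cong₂ (λ y z → (sqnorm i + x * y) + x * (z + x * sqnorm j)) (orthogonal (i≢j ∘ sym)) (orthogonal i≢j) ⟩
    (sqnorm i + x * 0ℚ) + x * (0ℚ + x * sqnorm j)
      ≡⟨ solve 3 (λ a x c → (a :+ x :* con 0ℚ) :+ x :* (con 0ℚ :+ x :* c) := a :+ x :* x :* c) refl (sqnorm i) x (sqnorm j) ⟩
    sqnorm i + x * x * sqnorm j ∎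
    where
    open ≡-Reasoning
    v : Vecℚ
    v l = g i l + x * g j l
    expand : ∀ w → dot n v w ≡ dot n (g i) w + x * dot n (g j) w
    expand w = trans (dot-+ˡ n (g i) (λ l → x * g j l) w) (cong (λ z → dot n (g i) w + z) (dot-*ˡ n x (g j) w))

  sqnorm-first : dot n (b 0) (b 0) ≡ sqnorm 0
  sqnorm-first = ΣQ-cong n λ j _ → cong (λ z → z * z) (trans (decomposition 0 j) (ℚₚ.+-identityʳ (g 0 j)))

  sqnorm-second : dot n (b 1) (b 1) ≡ sqnorm 1 + μ n b 1 0 * μ n b 1 0 * sqnorm 0
  sqnorm-second = trans
    (ΣQ-cong n λ j _ → cong (λ z → z * z) (trans (decomposition 1 j) (cong (λ z → g 1 j + z) (ℚₚ.+-identityˡ (μ n b 1 0 * g 0 j)))))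
    (sqnorm-combination (μ n b 1 0) {1} {0} λ ())

-- LLL-reduced bases

2ℚ : ℚ
2ℚ = ℕ→ℚ 2

^ℚ-+ : ∀ q m n → q ^ℚ (m ℕ.+ n) ≡ (q ^ℚ m) * (q ^ℚ n)
^ℚ-+ q zero    n = sym (ℚₚ.*-identityˡ (q ^ℚ n))
^ℚ-+ q (suc m) n = trans (cong (q *_) (^ℚ-+ q m n)) (sym (ℚₚ.*-assoc q (q ^ℚ m) (q ^ℚ n)))

^ℚ-nonNeg : ∀ {q} n → 0ℚ ℚ.≤ q → 0ℚ ℚ.≤ q ^ℚ n
^ℚ-nonNeg zero    q≥0 = ℚₚ.nonNegative⁻¹ 1ℚ
^ℚ-nonNeg (suc n) q≥0 = *-nonNeg q≥0 (^ℚ-nonNeg n q≥0)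

2ℚ≥0 : 0ℚ ℚ.≤ 2ℚ
2ℚ≥0 = ℚₚ.nonNegative⁻¹ 2ℚ

module _ {n d : ℕ} {b : ℕ → Vecℚ} (reduced : LLLReduced n d b) where
  open LLLReduced reduced
  open GramSchmidt n b

  private
    ¼ : ℚ
    ¼ = ℚ.½ * ℚ.½

  sqnorm-nonNeg : ∀ i → 0ℚ ℚ.≤ sqnorm i
  sqnorm-nonNeg i = dot-self-nonNeg n (gs n b i)

  μ²≤¼ : ∀ {i j} → j < i → i < d → μ n b i j * μ n b i j ℚ.≤ ¼
  μ²≤¼ {i} {j} j<i i<d = subst (ℚ._≤ ¼) (sym (square-abs (μ n b i j)))
    (*-mono-≤ (ℚₚ.0≤∣p∣ (μ n b i j)) (size-reduced i j j<i i<d)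
              (ℚₚ.0≤∣p∣ (μ n b i j)) (size-reduced i j j<i i<d))

  -- The Lovász condition reads 3/4 |b*_i|² ≤ |b*_{i+1}|² + μ² |b*_i|², and size reduction gives μ²
  -- ≤ 1/4. The difference 3/4 - 1/4 = 1/2 is the origin of the factor 2.
  sqnorm-step : ∀ i → suc i < d → sqnorm i ℚ.≤ 2ℚ * sqnorm (suc i)
  sqnorm-step i 1+i<d = begin
    x                                    ≡⟨ solve 1 (λ x → x := con 2ℚ :* (con ¾ :* x :- con ¼ :* x)) refl x ⟩
    2ℚ * (¾ * x - ¼ * x)                 ≤⟨ ℚₚ.*-monoˡ-≤-nonNeg 2ℚ (ℚₚ.+-monoˡ-≤ (- (¼ * x)) ¾x≤) ⟩
    2ℚ * (y + ¼ * x - ¼ * x)             ≡⟨ cong (2ℚ *_) (solve 2 (λ y z → y :+ z :- z := y) refl y (¼ * x)) ⟩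
    2ℚ * y                               ∎
    where
    open ℚₚ.≤-Reasoning
    ¾ = (+ 3) ℚ./ 4
    x = sqnorm i
    y = sqnorm (suc i)
    m = μ n b (suc i) i
    ¾x≤ : ¾ * x ℚ.≤ y + ¼ * x
    ¾x≤ = begin
      ¾ * x            ≤⟨ lovasz (suc i) (s≤s z≤n) 1+i<d ⟩
      _                ≡⟨ sqnorm-combination m {suc i} {i} ℕₚ.1+n≢n ⟩
      y + m * m * x    ≤⟨ ℚₚ.+-monoʳ-≤ y (ℚₚ.*-monoʳ-≤-nonNeg x {{ℚ.nonNegative (sqnorm-nonNeg i)}}
                            (μ²≤¼ (ℕₚ.n<1+n i) 1+i<d)) ⟩
      y + ¼ * x        ∎

  private
    step-up : ∀ {x} i j → suc j < d → x ℚ.≤ (2ℚ ^ℚ i) * sqnorm j → x ℚ.≤ (2ℚ ^ℚ suc i) * sqnorm (suc j)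
    step-up {x} i j 1+j<d x≤ = begin
      x                                     ≤⟨ x≤ ⟩
      (2ℚ ^ℚ i) * sqnorm j                  ≤⟨ ℚₚ.*-monoˡ-≤-nonNeg (2ℚ ^ℚ i) {{ℚ.nonNegative (^ℚ-nonNeg i 2ℚ≥0)}}
                                                 (sqnorm-step j 1+j<d) ⟩
      (2ℚ ^ℚ i) * (2ℚ * sqnorm (suc j))     ≡⟨ solve 3 (λ p t z → p :* (t :* z) := t :* p :* z) refl
                                                 (2ℚ ^ℚ i) 2ℚ (sqnorm (suc j)) ⟩
      2ℚ * (2ℚ ^ℚ i) * sqnorm (suc j)       ∎
      where open ℚₚ.≤-Reasoning

  first-bound : ∀ i → i < d → dot n (b 0) (b 0) ℚ.≤ (2ℚ ^ℚ i) * sqnorm i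
  first-bound zero    i<d = ℚₚ.≤-reflexive (trans sqnorm-first (sym (ℚₚ.*-identityˡ (sqnorm 0))))
  first-bound (suc i) i<d = step-up i i i<d (first-bound i (ℕₚ.<-trans (ℕₚ.n<1+n i) i<d))

  -- In the base case |b_1|² = |b*_1|² + μ² |b*_0|² is at most (1 + 1/4·2) |b*_1|². The constant 3/2
  -- is relaxed to 2 so that the exponent equals the index of `sqnorm`, as in `first-bound`.
  second-bound : ∀ i → suc i < d → dot n (b 1) (b 1) ℚ.≤ (2ℚ ^ℚ suc i) * sqnorm (suc i)
  second-bound zero    1<d = begin
    dot n (b 1) (b 1)             ≡⟨ sqnorm-second ⟩
    y + m * m * x                 ≤⟨ ℚₚ.+-monoʳ-≤ y (*-mono-≤ (square-nonNeg m) (μ²≤¼ (s≤s z≤n) 1<d)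
                                       (sqnorm-nonNeg 0) (sqnorm-step 0 1<d)) ⟩
    y + ¼ * (2ℚ * y)              ≡⟨ solve 1 (λ y → y :+ con ¼ :* (con 2ℚ :* y) := con (1ℚ + ℚ.½) :* y) refl y ⟩
    (1ℚ + ℚ.½) * y                ≤⟨ ℚₚ.*-monoʳ-≤-nonNeg y {{ℚ.nonNegative (sqnorm-nonNeg 1)}} 1½≤2 ⟩
    (2ℚ ^ℚ 1) * y                 ∎
    where
    open ℚₚ.≤-Reasoning
    x = sqnorm 0
    y = sqnorm 1
    m = μ n b 1 0
    1½≤2 : 1ℚ + ℚ.½ ℚ.≤ 2ℚ ^ℚ 1
    1½≤2 = ℚₚ.≤ᵇ⇒≤ _
  second-bound (suc i) 2+i<d = step-up (suc i) (suc i) 2+i<d (second-bound i (ℕₚ.<-trans (ℕₚ.n<1+n (suc i)) 2+i<d))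

ΠQ : ℕ → (ℕ → ℚ) → ℚ
ΠQ zero    f = 1ℚ
ΠQ (suc n) f = ΠQ n f * f n

-- The sum 0 + 1 + ... + (n-1): the total exponent of 2 once the single bounds are multiplied.
triangular : ℕ → ℕ
triangular zero    = 0
triangular (suc n) = triangular n ℕ.+ n

triangular-double : ∀ n → triangular n ℕ.* 2 ≡ n ℕ.* (n ∸ 1)
triangular-double zero          = refl
triangular-double (suc zero)    = refl
triangular-double (suc (suc n)) = trans (ℕₚ.*-distribʳ-+ 2 (triangular (suc n)) (suc n))
  (trans (cong (ℕ._+ suc n ℕ.* 2) (triangular-double (suc n)))
    (solveℕ 1 (λ n → (conℕ 1 ⊕ n) ⊛ n ⊕ (conℕ 1 ⊕ n) ⊛ conℕ 2 ⊜ (conℕ 2 ⊕ n) ⊛ (conℕ 1 ⊕ n)) refl n))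

triangular-half : ∀ n → (n ℕ.* (n ∸ 1)) ℕ./ 2 ≡ triangular n
triangular-half n = trans (cong (ℕ._/ 2) (sym (triangular-double n))) (m*n/n≡m (triangular n) 2)

-- The bounds with indices o, ..., o+k-1 are multiplied. The first `o` factors of the product are
-- not compared with `x`; the premise with left side 1 lets them enter for free.
power-bound : ∀ {x f} → 0ℚ ℚ.≤ x → ∀ k o → (∀ i → i < k → x ℚ.≤ (2ℚ ^ℚ (i ℕ.+ o)) * f (i ℕ.+ o)) →
  1ℚ ℚ.≤ (2ℚ ^ℚ triangular o) * ΠQ o f →
  x ^ℚ k ℚ.≤ (2ℚ ^ℚ triangular (k ℕ.+ o)) * ΠQ (k ℕ.+ o) f
power-bound         x≥0 zero    o x≤ base = base
power-bound {x} {f} x≥0 (suc k) o x≤ base = begin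
  x * (x ^ℚ k)
    ≤⟨ *-mono-≤ x≥0 (x≤ k (ℕₚ.n<1+n k)) (^ℚ-nonNeg k x≥0)
         (power-bound x≥0 k o (λ i i<k → x≤ i (ℕₚ.m<n⇒m<1+n i<k)) base) ⟩
  ((2ℚ ^ℚ l) * f l) * ((2ℚ ^ℚ triangular l) * ΠQ l f)
    ≡⟨ solve 4 (λ a b c e → a :* b :* (c :* e) := c :* a :* (e :* b)) refl
         (2ℚ ^ℚ l) (f l) (2ℚ ^ℚ triangular l) (ΠQ l f) ⟩
  ((2ℚ ^ℚ triangular l) * (2ℚ ^ℚ l)) * (ΠQ l f * f l)
    ≡⟨ cong (_* (ΠQ l f * f l)) (^ℚ-+ 2ℚ (triangular l) l) ⟨
  (2ℚ ^ℚ triangular (suc l)) * ΠQ (suc l) f ∎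
  where
  open ℚₚ.≤-Reasoning
  l = k ℕ.+ o

-- The volume of a lattice of corank one

ΣQ-sum : ∀ n (f : ℕ → ℚ) → ΣQ n f ≡ sum {n} (λ i → f (toℕ i))
ΣQ-sum zero    f = refl
ΣQ-sum (suc n) f = trans (ΣQ-suc n f) (cong (λ z → f 0 + z) (ΣQ-sum n (f ∘ suc)))
  where
  ΣQ-suc : ∀ n (f : ℕ → ℚ) → ΣQ (suc n) f ≡ f 0 + ΣQ n (f ∘ suc)
  ΣQ-suc zero    f = ℚₚ.+-comm 0ℚ (f 0)
  ΣQ-suc (suc n) f = trans (cong (_+ f (suc n)) (ΣQ-suc n f)) (ℚₚ.+-assoc (f 0) (ΣQ n (f ∘ suc)) (f (suc n)))

ΠQ-prod : ∀ n (f : ℕ → ℚ) → ΠQ n f ≡ prod {n} (λ i → f (toℕ i))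
ΠQ-prod zero    f = refl
ΠQ-prod (suc n) f = trans (ΠQ-suc n f) (cong (f 0 *_) (ΠQ-prod n (f ∘ suc)))
  where
  ΠQ-suc : ∀ n (f : ℕ → ℚ) → ΠQ (suc n) f ≡ f 0 * ΠQ n (f ∘ suc)
  ΠQ-suc zero    f = ℚₚ.*-comm 1ℚ (f 0)
  ΠQ-suc (suc n) f = trans (cong (_* f (suc n)) (ΠQ-suc n f)) (ℚₚ.*-assoc (f 0) (ΠQ n (f ∘ suc)) (f (suc n)))

ΠQ-nonNeg : ∀ n {f : ℕ → ℚ} → (∀ i → 0ℚ ℚ.≤ f i) → 0ℚ ℚ.≤ ΠQ n f
ΠQ-nonNeg zero    f≥0 = ℚₚ.nonNegative⁻¹ 1ℚ
ΠQ-nonNeg (suc n) f≥0 = *-nonNeg (ΠQ-nonNeg n f≥0) (f≥0 n)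

prod-one : ∀ n {f : Fin n → ℚ} → (∀ i → f i ≡ 1ℚ) → prod f ≡ 1ℚ
prod-one zero    eq = refl
prod-one (suc n) eq = cong₂ _*_ (eq zero) (prod-one n λ i → eq (suc i))

ΣQ-truncate : ∀ {m n} {f : ℕ → ℚ} → m ≤ n → (∀ i → m ≤ i → i < n → f i ≡ 0ℚ) → ΣQ n f ≡ ΣQ m f
ΣQ-truncate {m} {n} m≤n f≡0 with m ℕ.≟ n
ΣQ-truncate {m} {n}     m≤n f≡0 | yes refl = refl
ΣQ-truncate {zero}  {zero}  m≤n f≡0 | no m≢n = refl
ΣQ-truncate {m} {suc n} {f} m≤n f≡0 | no m≢n = trans
  (cong₂ _+_ (ΣQ-truncate m≤n′ λ i m≤i i<n → f≡0 i m≤i (ℕₚ.m<n⇒m<1+n i<n)) (f≡0 n m≤n′ (ℕₚ.n<1+n n)))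
  (ℚₚ.+-identityʳ (ΣQ m f))
  where m≤n′ = ℕₚ.≤-pred (ℕₚ.≤∧≢⇒< m≤n m≢n)

I-zero : {i j : Fin n} → toℕ i < toℕ j → I i j ≡ 0ℚ
I-zero {i = zero}  {suc j} _         = refl
I-zero {i = suc i} {suc j} (s≤s i<j) = I-zero i<j

I-diagonal : (i : Fin n) → I i i ≡ 1ℚ
I-diagonal zero    = refl
I-diagonal (suc i) = I-diagonal i

⊗-I : (A : Mat k n) → A ⊗ I ≐ A
⊗-I A i zero = trans
  (cong₂ _+_ (ℚₚ.*-identityʳ (A i zero)) (sum-zero λ l → ℚₚ.*-zeroʳ (A i (suc l))))
  (ℚₚ.+-identityʳ (A i zero))
⊗-I A i (suc j) = trans
  (cong₂ _+_ (ℚₚ.*-zeroʳ (A i zero)) (⊗-I (λ r l → A r (suc l)) i j))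
  (ℚₚ.+-identityˡ (A i (suc j)))

-- The block matrix 1 ⊕ V fixes the row `w` and acts on the rows below it, so that a change of basis
-- becomes a product of square matrices.
border : ∀ {d} → (ℕ → ℕ → ℚ) → Mat (suc d) (suc d)
border V zero    zero    = 1ℚ
border V zero    (suc j) = 0ℚ
border V (suc i) zero    = 0ℚ
border V (suc i) (suc j) = V (toℕ i) (toℕ j)

stack : ∀ {d} → Vecℚ → (ℕ → Vecℚ) → Mat (suc d) (suc d)
stack w b zero    j = w (toℕ j)
stack w b (suc i) j = b (toℕ i) (toℕ j)

stack-border : ∀ {d} w {b b′ : ℕ → Vecℚ} (V : ℕ → ℕ → ℚ) →
  (∀ i j → i < d → j < suc d → b′ i j ≡ ΣQ d (λ r → V i r * b r j)) →
  stack {d} w b′ ≐ border V ⊗ stack w b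
stack-border {d} w {b} V eq zero j = sym (trans
  (cong₂ _+_ (ℚₚ.*-identityˡ (w (toℕ j))) (sum-zero {d} λ l → ℚₚ.*-zeroˡ (b (toℕ l) (toℕ j))))
  (ℚₚ.+-identityʳ (w (toℕ j))))
stack-border {d} w {b} V eq (suc i) j = begin
  _                                                  ≡⟨ eq (toℕ i) (toℕ j) (Finₚ.toℕ<n i) (Finₚ.toℕ<n j) ⟩
  ΣQ d (λ r → V (toℕ i) r * b r (toℕ j))             ≡⟨ ΣQ-sum d (λ r → V (toℕ i) r * b r (toℕ j)) ⟩
  S                                                  ≡⟨ ℚₚ.+-identityˡ S ⟨
  0ℚ + S                                             ≡⟨ cong (_+ S) (ℚₚ.*-zeroˡ (w (toℕ j))) ⟨
  0ℚ * w (toℕ j) + S                                 ∎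
  where
  open ≡-Reasoning
  S = sum {d} (λ r → V (toℕ i) (toℕ r) * b (toℕ r) (toℕ j))

-- Gram-Schmidt writes b as a unitriangular matrix `L` times b*, and `border L` has `detSq` 1. After
-- this replacement the rows w, b*_0, ..., b*_{d-1} are pairwise orthogonal.
detSq-gramSchmidt : ∀ {d} w (b : ℕ → Vecℚ) → (∀ i → i < d → dot (suc d) (b i) w ≡ 0ℚ) →
  detSq (stack {d} w b) ≡ dot (suc d) w w * ΠQ d (GramSchmidt.sqnorm (suc d) b)
detSq-gramSchmidt {d} w b b⊥w = begin
  detSq (stack {d} w b)                       ≡⟨ detSq-cong (stack-border w L expand) ⟩
  detSq (border L ⊗ stack {d} w g)            ≡⟨ detSq-⊗ (border L) (stack {d} w g) ⟩
  detSq (border {d} L) * detSq (stack {d} w g)    ≡⟨ cong₂ _*_ detSq-L detSq-g ⟩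
  1ℚ * (dot (suc d) w w * ΠQ d sqnorm)        ≡⟨ ℚₚ.*-identityˡ _ ⟩
  dot (suc d) w w * ΠQ d sqnorm               ∎
  where
  open ≡-Reasoning
  open GramSchmidt (suc d) b
  g = gs (suc d) b
  L : ℕ → ℕ → ℚ
  L i r with ℕₚ.<-cmp r i
  ... | tri< _ _ _ = μ (suc d) b i r
  ... | tri≈ _ _ _ = 1ℚ
  ... | tri> _ _ _ = 0ℚ
  L-below : ∀ {i r} → r < i → L i r ≡ μ (suc d) b i r
  L-below {i} {r} r<i with ℕₚ.<-cmp r i
  ... | tri< _ _ _    = refl
  ... | tri≈ r≮i _ _  = ⊥-elim (r≮i r<i)
  ... | tri> r≮i _ _  = ⊥-elim (r≮i r<i)
  L-diagonal : ∀ i → L i i ≡ 1ℚ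
  L-diagonal i with ℕₚ.<-cmp i i
  ... | tri< _ i≢i _ = ⊥-elim (i≢i refl)
  ... | tri≈ _ _ _   = refl
  ... | tri> _ i≢i _ = ⊥-elim (i≢i refl)
  L-above : ∀ {i r} → i < r → L i r ≡ 0ℚ
  L-above {i} {r} i<r with ℕₚ.<-cmp r i
  ... | tri< _ _ i≮r = ⊥-elim (i≮r i<r)
  ... | tri≈ _ _ i≮r = ⊥-elim (i≮r i<r)
  ... | tri> _ _ _   = refl
  expand : ∀ i j → i < d → j < suc d → b i j ≡ ΣQ d (λ r → L i r * g r j)
  expand i j i<d _ = begin
    b i j
      ≡⟨ decomposition i j ⟩
    g i j + ΣQ i (λ r → μ (suc d) b i r * g r j)
      ≡⟨ ℚₚ.+-comm (g i j) _ ⟩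
    ΣQ i (λ r → μ (suc d) b i r * g r j) + g i j
      ≡⟨ cong₂ _+_ (ΣQ-cong i λ r r<i → cong (_* g r j) (sym (L-below r<i)))
           (trans (sym (ℚₚ.*-identityˡ (g i j))) (cong (_* g i j) (sym (L-diagonal i)))) ⟩
    ΣQ (suc i) (λ r → L i r * g r j)
      ≡⟨ ΣQ-truncate i<d (λ r i<r _ → trans (cong (_* g r j) (L-above i<r)) (ℚₚ.*-zeroˡ (g r j))) ⟨
    ΣQ d (λ r → L i r * g r j) ∎
  detSq-L : detSq (border {d} L) ≡ 1ℚ
  detSq-L = trans (detSq-lower (border {d} L) lower) (cong₂ _*_ ones ones)
    where
    lower : (i j : Fin (suc d)) → toℕ i < toℕ j → border L i j ≡ 0ℚ
    lower zero    (suc j) _         = refl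
    lower (suc i) (suc j) (s≤s i<j) = L-above i<j
    ones : prod {suc d} (λ i → border L i i) ≡ 1ℚ
    ones = prod-one (suc d) {λ i → border L i i} λ { zero → refl ; (suc i) → L-diagonal (toℕ i) }
  gram : ∀ i j → (stack {d} w g ⊗ stack {d} w g ᵀ) (suc i) (suc j) ≡ dot (suc d) (g (toℕ i)) (g (toℕ j))
  gram i j = sym (ΣQ-sum (suc d) (λ l → g (toℕ i) l * g (toℕ j) l))
  g⊥w : ∀ i → i < d → dot (suc d) (g i) w ≡ 0ℚ
  g⊥w = orthogonal-complement w d b⊥w
  gram-zero : ∀ i j → i ≢ j → (stack {d} w g ⊗ stack {d} w g ᵀ) i j ≡ 0ℚ
  gram-zero zero    zero    0≢0 = ⊥-elim (0≢0 refl)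
  gram-zero zero    (suc j) _   = trans (sym (ΣQ-sum (suc d) (λ l → w l * g (toℕ j) l)))
    (trans (dot-comm (suc d) w (g (toℕ j))) (g⊥w (toℕ j) (Finₚ.toℕ<n j)))
  gram-zero (suc i) zero    _   = trans (sym (ΣQ-sum (suc d) (λ l → g (toℕ i) l * w l)))
    (g⊥w (toℕ i) (Finₚ.toℕ<n i))
  gram-zero (suc i) (suc j) i≢j = trans (gram i j)
    (orthogonal λ i≡j → i≢j (cong suc (Finₚ.toℕ-injective i≡j)))
  detSq-g : detSq (stack {d} w g) ≡ dot (suc d) w w * ΠQ d sqnorm
  detSq-g = trans (detSq-orthogonal (stack {d} w g) gram-zero)
    (cong₂ _*_ (sym (ΣQ-sum (suc d) (λ l → w l * w l)))
      (trans (prod-cong {d} λ i → gram i i) (sym (ΠQ-prod d sqnorm))))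

-- Multiplying on the right by the matrix with columns w, e₁, …, e_d clears the first column
-- below the diagonal, since every row of b is orthogonal to w.
detSq-shifted-lower : ∀ {d} w (b : ℕ → Vecℚ) → (∀ i → i < d → dot (suc d) (b i) w ≡ 0ℚ) →
  (∀ i j → i < j → j < d → b i (suc j) ≡ 0ℚ) →
  let W = dot (suc d) w w ; D = ΠQ d (λ i → b i (suc i)) in
  detSq (stack {d} w b) * (w 0 * w 0) ≡ W * W * (D * D)
detSq-shifted-lower {d} w b b⊥w lower = begin
  detSq M * (w 0 * w 0)                   ≡⟨ cong (detSq M *_) detSq-T ⟨
  detSq M * detSq T                       ≡⟨ detSq-⊗ M T ⟨
  detSq (M ⊗ T)                           ≡⟨ detSq-cleared-column (M ⊗ T) cleared ⟩
  (M ⊗ T) zero zero * (M ⊗ T) zero zero * detSq (minor (M ⊗ T) zero)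
    ≡⟨ cong₂ (λ x y → x * x * y) (sym (ΣQ-sum (suc d) (λ l → w l * w l))) detSq-minor ⟩
  W * W * (D * D)                         ∎
  where
  open ≡-Reasoning
  W = dot (suc d) w w
  D = ΠQ d (λ i → b i (suc i))
  M : Mat (suc d) (suc d)
  M = stack w b
  T : Mat (suc d) (suc d)
  T l zero    = w (toℕ l)
  T l (suc j) = I l (suc j)
  cleared : ∀ i → (M ⊗ T) (suc i) zero ≡ 0ℚ
  cleared i = trans (sym (ΣQ-sum (suc d) (λ l → b (toℕ i) l * w l))) (b⊥w (toℕ i) (Finₚ.toℕ<n i))
  minor-entry : ∀ i j → minor (M ⊗ T) zero i j ≡ b (toℕ i) (suc (toℕ j))
  minor-entry i j = ⊗-I M (suc i) (suc j)
  diagonal : prod (λ i → minor (M ⊗ T) zero i i) ≡ D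
  diagonal = trans (prod-cong {d} λ i → minor-entry i i) (sym (ΠQ-prod d (λ i → b i (suc i))))
  detSq-minor : detSq (minor (M ⊗ T) zero) ≡ D * D
  detSq-minor = trans
    (detSq-lower (minor (M ⊗ T) zero) λ i j i<j →
      trans (minor-entry i j) (lower (toℕ i) (toℕ j) i<j (Finₚ.toℕ<n j)))
    (cong₂ _*_ diagonal diagonal)
  detSq-T : detSq T ≡ w 0 * w 0
  detSq-T = trans (detSq-lower T T-lower) (cong₂ _*_ T-diagonal T-diagonal)
    where
    T-lower : ∀ i j → toℕ i < toℕ j → T i j ≡ 0ℚ
    T-lower i (suc j) i<j = I-zero {i = i} i<j
    T-diagonal : prod (λ i → T i i) ≡ w 0
    T-diagonal = trans (cong (w 0 *_) (prod-one d λ i → I-diagonal i)) (ℚₚ.*-identityʳ (w 0))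

nonNeg∧≢0⇒pos : ∀ {x} → 0ℚ ℚ.≤ x → x ≢ 0ℚ → 0ℚ ℚ.< x
nonNeg∧≢0⇒pos {x} x≥0 x≢0 = ℚₚ.≰⇒> λ x≤0 → x≢0 (ℚₚ.≤-antisym x≤0 x≥0)

square-pos : ∀ {x} → x ≢ 0ℚ → 0ℚ ℚ.< x * x
square-pos {x} x≢0 = nonNeg∧≢0⇒pos (square-nonNeg x) (x≢0 ∘ square-zero)

pos-factorˡ : ∀ {x y} → 0ℚ ℚ.≤ y → 0ℚ ℚ.< x * y → 0ℚ ℚ.< x
pos-factorˡ {x} {y} y≥0 xy>0 = ℚₚ.≰⇒> λ x≤0 → ℚₚ.<-irrefl refl (ℚₚ.<-≤-trans xy>0
  (subst (x * y ℚ.≤_) (ℚₚ.*-zeroˡ y) (ℚₚ.*-monoʳ-≤-nonNeg y {{ℚ.nonNegative y≥0}} x≤0)))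

*-pos : ∀ {x y} → 0ℚ ℚ.< x → 0ℚ ℚ.< y → 0ℚ ℚ.< x * y
*-pos {x} {y} x>0 y>0 = ℚₚ.positive⁻¹ (x * y) {{ℚₚ.pos*pos⇒pos x {{ℚ.positive x>0}} y {{ℚ.positive y>0}}}}

cancel-≤ : ∀ {x y r} → 0ℚ ℚ.< r → x * r ℚ.≤ y * r → x ℚ.≤ y
cancel-≤ {r = r} r>0 = ℚₚ.*-cancelʳ-≤-pos r {{ℚ.positive r>0}}

-- Only b′ = V b with V integral is used, not unimodularity: a positive integer detSq V is ≥ 1,
-- which already bounds the volume of b by that of b′.
module _ {d : ℕ} (w : Vecℚ) (b b′ : ℕ → Vecℚ) (V : ℕ → ℕ → ℚ)
  (V-integral : ∀ i r → Integral (V i r))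
  (b′≡Vb : ∀ i j → i < d → j < suc d → b′ i j ≡ ΣQ d (λ r → V i r * b r j))
  (b⊥w : ∀ i → i < d → dot (suc d) (b i) w ≡ 0ℚ)
  (b′⊥w : ∀ i → i < d → dot (suc d) (b′ i) w ≡ 0ℚ)
  (b′-lower : ∀ i j → i < j → j < d → b′ i (suc j) ≡ 0ℚ)
  (w₀≢0 : w 0 ≢ 0ℚ)
  (D≢0 : ΠQ d (λ i → b′ i (suc i)) ≢ 0ℚ)
  where
  private
    W = dot (suc d) w w
    D = ΠQ d (λ i → b′ i (suc i))
    Π = ΠQ d (GramSchmidt.sqnorm (suc d) b)
    v = detSq (border {d} V)
    Δ = detSq (stack {d} w b′)

    W>0 : 0ℚ ℚ.< W
    W>0 = nonNeg∧≢0⇒pos (dot-self-nonNeg (suc d) w) λ W≡0 →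
      w₀≢0 (square-zero (ΣQ-nonNeg-zero (suc d) (λ j → square-nonNeg (w j)) W≡0 0 (s≤s z≤n)))

    Π≥0 : 0ℚ ℚ.≤ Π
    Π≥0 = ΠQ-nonNeg d λ i → dot-self-nonNeg (suc d) (gs (suc d) b i)

    WΠ≥0 : 0ℚ ℚ.≤ W * Π
    WΠ≥0 = *-nonNeg (ℚₚ.<⇒≤ W>0) Π≥0

    Δ-eq : Δ * (w 0 * w 0) ≡ W * W * (D * D)
    Δ-eq = detSq-shifted-lower w b′ b′⊥w b′-lower

    Δ>0 : 0ℚ ℚ.< Δ
    Δ>0 = pos-factorˡ (square-nonNeg (w 0))
      (subst (0ℚ ℚ.<_) (sym Δ-eq) (*-pos (*-pos W>0 W>0) (square-pos D≢0)))

    Δ≡v*WΠ : Δ ≡ v * (W * Π)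
    Δ≡v*WΠ = trans (detSq-cong (stack-border w V b′≡Vb))
      (trans (detSq-⊗ (border {d} V) (stack {d} w b)) (cong (v *_) (detSq-gramSchmidt w b b⊥w)))

    border-integral : ∀ (i j : Fin (suc d)) → Integral (border V i j)
    border-integral zero    zero    = + 1 , refl
    border-integral zero    (suc j) = + 0 , refl
    border-integral (suc i) zero    = + 0 , refl
    border-integral (suc i) (suc j) = V-integral (toℕ i) (toℕ j)

    v≥1 : 1ℚ ℚ.≤ v
    -- Positivity of `v` follows because its product with the nonnegative W Π is Δ > 0.
    v≥1 = integral-pos⇒≥1
      (integral-* (integral-det (border {d} V) border-integral)
                  (integral-det (border {d} V ᵀ) λ i j → border-integral j i))
      (pos-factorˡ WΠ≥0 (subst (0ℚ ℚ.<_) Δ≡v*WΠ Δ>0))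

  volume-pos : 0ℚ ℚ.< Π
  volume-pos = nonNeg∧≢0⇒pos Π≥0 λ Π≡0 → ℚₚ.<-irrefl refl (subst (0ℚ ℚ.<_)
    (trans Δ≡v*WΠ (trans (cong (λ z → v * (W * z)) Π≡0)
      (solve 2 (λ x y → x :* (y :* con 0ℚ) := con 0ℚ) refl v W))) Δ>0)

  -- Δ is known in two ways: as v W Π from the change of basis, and as W² D² / w_0² from the
  -- triangular shape. With v ≥ 1 one factor W cancels; the factor W left over is what brings ‖c‖
  -- into the bound.
  volume-≤ : Π * (w 0 * w 0) ℚ.≤ W * (D * D)
  volume-≤ = cancel-≤ W>0 (begin
    Π * (w 0 * w 0) * W             ≡⟨ solve 3 (λ x y z → x :* y :* z := con 1ℚ :* (z :* x) :* y) refl Π (w 0 * w 0) W ⟩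
    1ℚ * (W * Π) * (w 0 * w 0)      ≤⟨ ℚₚ.*-monoʳ-≤-nonNeg (w 0 * w 0) {{ℚ.nonNegative (square-nonNeg (w 0))}}
                                         (ℚₚ.*-monoʳ-≤-nonNeg (W * Π) {{ℚ.nonNegative WΠ≥0}} v≥1) ⟩
    v * (W * Π) * (w 0 * w 0)       ≡⟨ cong (_* (w 0 * w 0)) Δ≡v*WΠ ⟨
    Δ * (w 0 * w 0)                 ≡⟨ Δ-eq ⟩
    W * W * (D * D)                 ≡⟨ solve 2 (λ x y → x :* x :* y := x :* y :* x) refl W (D * D) ⟩
    W * (D * D) * W                 ∎)
    where open ℚₚ.≤-Reasoning

-- The weighted norms

^ℚ-≢0 : ∀ {q} n → q ≢ 0ℚ → q ^ℚ n ≢ 0ℚ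
^ℚ-≢0 zero    q≢0 = ℚₚ.1≢0
^ℚ-≢0 (suc n) q≢0 = ^ℚ-≢0 n q≢0 ∘ *-cancel-0 q≢0

^ℤ-neg : ∀ {q} n → q ≢ 0ℚ → (q ^ℤ (ℤ.- (+ n))) * (q ^ℚ n) ≡ 1ℚ
^ℤ-neg     zero    q≢0 = refl
^ℤ-neg {q} (suc n) q≢0 = ÷₀-* 1ℚ (q ^ℚ suc n) λ eq → ⊥-elim (^ℚ-≢0 (suc n) q≢0 eq)

-- The weight s^{2i-e} in the norm may have a negative exponent; multiplication by s^e returns to
-- natural powers in either case.
^ℤ-sub : ∀ {q} n e → q ≢ 0ℚ → (q ^ℚ e) * (q ^ℤ (+ n ℤ.- + e)) ≡ q ^ℚ n
^ℤ-sub {q} n e q≢0 rewrite ℤₚ.[+m]-[+n]≡m⊖n n e with e ℕ.≤? n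
... | yes e≤n rewrite ℤₚ.⊖-≥ e≤n = trans (sym (^ℚ-+ q e (n ∸ e))) (cong (q ^ℚ_) (ℕₚ.m+[n∸m]≡n e≤n))
... | no e≰n rewrite ℤₚ.⊖-≤ (ℕₚ.<⇒≤ (ℕₚ.≰⇒> e≰n)) = begin
  (q ^ℚ e) * y                       ≡⟨ cong (λ z → (q ^ℚ z) * y) (sym (ℕₚ.m+[n∸m]≡n (ℕₚ.<⇒≤ (ℕₚ.≰⇒> e≰n)))) ⟩
  (q ^ℚ (n ℕ.+ (e ∸ n))) * y         ≡⟨ cong (_* y) (^ℚ-+ q n (e ∸ n)) ⟩
  (q ^ℚ n) * (q ^ℚ (e ∸ n)) * y      ≡⟨ solve 3 (λ a b c → a :* b :* c := a :* (c :* b)) refl (q ^ℚ n) (q ^ℚ (e ∸ n)) y ⟩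
  (q ^ℚ n) * (y * (q ^ℚ (e ∸ n)))    ≡⟨ cong ((q ^ℚ n) *_) (^ℤ-neg (e ∸ n) q≢0) ⟩
  (q ^ℚ n) * 1ℚ                      ≡⟨ ℚₚ.*-identityʳ (q ^ℚ n) ⟩
  q ^ℚ n                             ∎
  where
  open ≡-Reasoning
  y = q ^ℤ (ℤ.- (+ (e ∸ n)))

deg-≤ : ∀ n h → deg (suc n) h ≤ n
deg-≤ n h with h n ℤ.≟ + 0
... | no _ = ℕₚ.≤-refl
deg-≤ zero    h | yes _ = ℕₚ.≤-refl
deg-≤ (suc n) h | yes _ = ℕₚ.m≤n⇒m≤1+n (deg-≤ n h)

coefficient-above-deg : ∀ n h i → deg n h < i → i < n → h i ≡ + 0
coefficient-above-deg (suc n) h i e<i i<1+n with h n ℤ.≟ + 0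
... | no _ = ⊥-elim (ℕₚ.<⇒≱ e<i (ℕₚ.≤-pred i<1+n))
... | yes hn≡0 with i ℕ.≟ n
... | yes refl = hn≡0
... | no i≢n   = coefficient-above-deg n h i e<i (ℕₚ.≤∧≢⇒< (ℕₚ.≤-pred i<1+n) i≢n)

^ℚ-double : ∀ q i → q ^ℚ (2 ℕ.* i) ≡ (q ^ℚ i) * (q ^ℚ i)
^ℚ-double q i = trans (cong (λ z → q ^ℚ (i ℕ.+ z)) (ℕₚ.+-identityʳ i)) (^ℚ-+ q i i)

-- The factor s^e turns each weight s^{2i-e} into s^{2i}, which no longer depends on the degree.
-- Coefficients above the degree are zero, so the sum may run up to d.
norm2s²-scaled : ∀ d (C : ℕ → ℕ → ℤ) s r → ℕ→ℚ s ≢ 0ℚ →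
  (ℕ→ℚ s ^ℚ deg (suc d) (C r)) * norm2s² (suc d) (C r) s ≡ dot (suc d) (scaleRows C s r) (scaleRows C s r)
norm2s²-scaled d C s r S≢0 = begin
  (S ^ℚ e) * norm2s² (suc d) h s
    ≡⟨ ΣQ-*ˡ (suc e) (S ^ℚ e) (λ i → ℤ→ℚ (h i) * ℤ→ℚ (h i) * (S ^ℤ (+ (2 ℕ.* i) ℤ.- + e))) ⟨
  ΣQ (suc e) (λ i → (S ^ℚ e) * (ℤ→ℚ (h i) * ℤ→ℚ (h i) * (S ^ℤ (+ (2 ℕ.* i) ℤ.- + e))))
    ≡⟨ ΣQ-cong (suc e) (λ i _ → term i) ⟩
  ΣQ (suc e) (λ i → u i * u i)
    ≡⟨ ΣQ-truncate (s≤s (deg-≤ d h)) above ⟨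
  ΣQ (suc d) (λ i → u i * u i) ∎
  where
  open ≡-Reasoning
  S = ℕ→ℚ s
  h = C r
  e = deg (suc d) h
  u = scaleRows C s r
  term : ∀ i → (S ^ℚ e) * (ℤ→ℚ (h i) * ℤ→ℚ (h i) * (S ^ℤ (+ (2 ℕ.* i) ℤ.- + e))) ≡ u i * u i
  term i = begin
    (S ^ℚ e) * (x * x * y)            ≡⟨ solve 3 (λ a x y → a :* (x :* x :* y) := x :* x :* (a :* y)) refl (S ^ℚ e) x y ⟩
    x * x * ((S ^ℚ e) * y)            ≡⟨ cong (x * x *_) (trans (^ℤ-sub (2 ℕ.* i) e S≢0) (^ℚ-double S i)) ⟩
    x * x * ((S ^ℚ i) * (S ^ℚ i))     ≡⟨ solve 2 (λ x a → x :* x :* (a :* a) := x :* a :* (x :* a)) refl x (S ^ℚ i) ⟩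
    u i * u i                         ∎
    where
    x = ℤ→ℚ (h i)
    y = S ^ℤ (+ (2 ℕ.* i) ℤ.- + e)
  above : ∀ i → suc e ≤ i → i < suc d → u i * u i ≡ 0ℚ
  above i e<i i<1+d rewrite coefficient-above-deg (suc d) h i e<i i<1+d | ℚₚ.*-zeroˡ (S ^ℚ i) = refl

-- The weight s^{d-j} complements the weight s^j of column j, so pairing with a scaled row of B
-- gives s^d Σ_j B_j c_j, without any division by s.
dualVector : ℕ → ℕ → (ℕ → ℤ) → Vecℚ
dualVector d s c j = ℤ→ℚ (c j) * (ℕ→ℚ s ^ℚ (d ∸ j))

norm2sInv²-scaled : ∀ d c s → ℕ→ℚ s ≢ 0ℚ →
  dot (suc d) (dualVector d s c) (dualVector d s c) ≡ (ℕ→ℚ s ^ℚ d) * norm2sInv² d c s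
norm2sInv²-scaled d c s S≢0 = begin
  ΣQ (suc d) (λ i → w i * w i)
    ≡⟨ ΣQ-cong (suc d) (λ i i<1+d → term i (ℕₚ.≤-pred i<1+d)) ⟩
  ΣQ (suc d) (λ i → (S ^ℚ d) * (S ^ℚ d) * f i)
    ≡⟨ ΣQ-*ˡ (suc d) ((S ^ℚ d) * (S ^ℚ d)) f ⟩
  (S ^ℚ d) * (S ^ℚ d) * ΣQ (suc d) f
    ≡⟨ ℚₚ.*-assoc (S ^ℚ d) (S ^ℚ d) (ΣQ (suc d) f) ⟩
  (S ^ℚ d) * norm2sInv² d c s ∎
  where
  open ≡-Reasoning
  S = ℕ→ℚ s
  w = dualVector d s c
  f : ℕ → ℚ
  f i = ℤ→ℚ (c i) * ℤ→ℚ (c i) * (S ^ℤ (ℤ.- (+ (2 ℕ.* i))))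
  term : ∀ i → i ≤ d → w i * w i ≡ (S ^ℚ d) * (S ^ℚ d) * f i
  term i i≤d = begin
    x * z * (x * z)
      ≡⟨ solve 2 (λ x z → x :* z :* (x :* z) := con 1ℚ :* x :* x :* z :* z) refl x z ⟩
    1ℚ * x * x * z * z
      ≡⟨ cong (λ o → o * x * x * z * z) (trans (cong (y *_) (sym (^ℚ-double S i))) (^ℤ-neg (2 ℕ.* i) S≢0)) ⟨
    y * (t * t) * x * x * z * z
      ≡⟨ solve 4 (λ x y z t → y :* (t :* t) :* x :* x :* z :* z := (t :* z) :* (t :* z) :* (x :* x :* y)) refl x y z t ⟩
    (t * z) * (t * z) * f i
      ≡⟨ cong (λ o → o * o * f i) (trans (sym (^ℚ-+ S i (d ∸ i))) (cong (S ^ℚ_) (ℕₚ.m+[n∸m]≡n i≤d))) ⟩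
    (S ^ℚ d) * (S ^ℚ d) * f i ∎
    where
    x = ℤ→ℚ (c i)
    y = S ^ℤ (ℤ.- (+ (2 ℕ.* i)))
    z = S ^ℚ (d ∸ i)
    t = S ^ℚ i

-- The lattice of Algorithm B

ΣQ-pair : ∀ n {f : ℕ → ℚ} e → suc e < n → (∀ i → i < n → i ≢ e → i ≢ suc e → f i ≡ 0ℚ) →
          ΣQ n f ≡ f e + f (suc e)
ΣQ-pair (suc n) {f} e 1+e<1+n rest with suc e ℕ.≟ n
... | yes refl = cong (_+ f (suc e)) (ΣQ-single (suc e) e (ℕₚ.n<1+n e)
                   λ i i<n i≢e → rest i (ℕₚ.m<n⇒m<1+n i<n) i≢e (ℕₚ.<⇒≢ i<n))
... | no 1+e≢n = trans (cong₂ _+_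
    (ΣQ-pair n e 1+e<n λ i i<n → rest i (ℕₚ.m<n⇒m<1+n i<n))
    (rest n (ℕₚ.n<1+n n) (λ n≡e → ℕₚ.<⇒≢ (ℕₚ.<-trans (ℕₚ.n<1+n e) 1+e<n) (sym n≡e)) (1+e≢n ∘ sym)))
  (ℚₚ.+-identityʳ (f e + f (suc e)))
  where 1+e<n = ℕₚ.≤∧≢⇒< (ℕₚ.≤-pred 1+e<1+n) 1+e≢n

ℤ→ℚ-ΣZ : ∀ n f → ℤ→ℚ (ΣZ n f) ≡ ΣQ n (λ i → ℤ→ℚ (f i))
ℤ→ℚ-ΣZ zero    f = refl
ℤ→ℚ-ΣZ (suc n) f = trans (ℤ→ℚ-homo-+ (ΣZ n f) (f n)) (cong (_+ ℤ→ℚ (f n)) (ℤ→ℚ-ΣZ n f))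

ℤ→ℚ-≢0 : ∀ {z} → z ≢ + 0 → ℤ→ℚ z ≢ 0ℚ
ℤ→ℚ-≢0 z≢0 eq = z≢0 (ℤ→ℚ-injective eq)

scaleRows-span : ∀ d s (B C U : ℕ → ℕ → ℤ) i j → C i j ≡ ΣZ d (λ r → U i r ℤ.* B r j) →
  scaleRows C s i j ≡ ΣQ d (λ r → ℤ→ℚ (U i r) * scaleRows B s r j)
scaleRows-span d s B C U i j eq = begin
  ℤ→ℚ (C i j) * t                                        ≡⟨ cong (λ z → ℤ→ℚ z * t) eq ⟩
  ℤ→ℚ (ΣZ d (λ r → U i r ℤ.* B r j)) * t                 ≡⟨ cong (_* t) (ℤ→ℚ-ΣZ d (λ r → U i r ℤ.* B r j)) ⟩
  ΣQ d (λ r → ℤ→ℚ (U i r ℤ.* B r j)) * t                 ≡⟨ ℚₚ.*-comm (ΣQ d (λ r → ℤ→ℚ (U i r ℤ.* B r j))) t ⟩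
  t * ΣQ d (λ r → ℤ→ℚ (U i r ℤ.* B r j))                 ≡⟨ ΣQ-*ˡ d t (λ r → ℤ→ℚ (U i r ℤ.* B r j)) ⟨
  ΣQ d (λ r → t * ℤ→ℚ (U i r ℤ.* B r j))                 ≡⟨ ΣQ-cong d (λ r _ → term r) ⟩
  ΣQ d (λ r → ℤ→ℚ (U i r) * scaleRows B s r j)           ∎
  where
  open ≡-Reasoning
  t = ℕ→ℚ s ^ℚ j
  term : ∀ r → t * ℤ→ℚ (U i r ℤ.* B r j) ≡ ℤ→ℚ (U i r) * (ℤ→ℚ (B r j) * t)
  term r = trans (cong (t *_) (ℤ→ℚ-homo-* (U i r) (B r j)))
    (solve 3 (λ t u b → t :* (u :* b) := u :* (b :* t)) refl t (ℤ→ℚ (U i r)) (ℤ→ℚ (B r j)))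

dot-dualVector : ∀ d s (B : ℕ → ℕ → ℤ) c r →
  dot (suc d) (scaleRows B s r) (dualVector d s c) ≡ (ℕ→ℚ s ^ℚ d) * ΣQ (suc d) (λ j → ℤ→ℚ (B r j ℤ.* c j))
dot-dualVector d s B c r = trans (ΣQ-cong (suc d) term)
  (ΣQ-*ˡ (suc d) (S ^ℚ d) (λ j → ℤ→ℚ (B r j ℤ.* c j)))
  where
  open ≡-Reasoning
  S = ℕ→ℚ s
  term : ∀ j → j < suc d → scaleRows B s r j * dualVector d s c j ≡ (S ^ℚ d) * ℤ→ℚ (B r j ℤ.* c j)
  term j j<1+d = begin
    x * (S ^ℚ j) * (y * (S ^ℚ (d ∸ j)))
      ≡⟨ solve 4 (λ x u y v → x :* u :* (y :* v) := (u :* v) :* (x :* y)) refl x (S ^ℚ j) y (S ^ℚ (d ∸ j)) ⟩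
    ((S ^ℚ j) * (S ^ℚ (d ∸ j))) * (x * y)
      ≡⟨ cong₂ _*_ (trans (sym (^ℚ-+ S j (d ∸ j))) (cong (S ^ℚ_) (ℕₚ.m+[n∸m]≡n (ℕₚ.≤-pred j<1+d))))
           (sym (ℤ→ℚ-homo-* (B r j) (c j))) ⟩
    (S ^ℚ d) * ℤ→ℚ (B r j ℤ.* c j) ∎
    where
    x = ℤ→ℚ (B r j)
    y = ℤ→ℚ (c j)

ΠQ-cong : ∀ n {f g : ℕ → ℚ} → (∀ i → i < n → f i ≡ g i) → ΠQ n f ≡ ΠQ n g
ΠQ-cong zero    eq = refl
ΠQ-cong (suc n) eq = cong₂ _*_ (ΠQ-cong n λ i i<n → eq i (ℕₚ.m<n⇒m<1+n i<n)) (eq n (ℕₚ.n<1+n n))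

ΠQ-zero : ∀ n {f : ℕ → ℚ} l → l < n → f l ≡ 0ℚ → ΠQ n f ≡ 0ℚ
ΠQ-zero (suc n) {f} l l<1+n fl≡0 with l ℕ.≟ n
... | yes refl = trans (cong (ΠQ n f *_) fl≡0) (ℚₚ.*-zeroʳ (ΠQ n f))
... | no l≢n   = trans (cong (_* f n) (ΠQ-zero n l (ℕₚ.≤∧≢⇒< (ℕₚ.≤-pred l<1+n) l≢n) fl≡0)) (ℚₚ.*-zeroˡ (f n))

integral-ΣQ : ∀ n {f : ℕ → ℚ} → (∀ i → Integral (f i)) → Integral (ΣQ n f)
integral-ΣQ zero    int = + 0 , refl
integral-ΣQ (suc n) int = integral-+ (integral-ΣQ n int) (int n)

integral-^ : ∀ {q} n → Integral q → Integral (q ^ℚ n)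
integral-^ zero    int = + 1 , refl
integral-^ (suc n) int = integral-* int (integral-^ n int)

-- Row r+1 of the matrix is x^e (px - m); the hypothesis locates its coefficient p in column e+1.
module _ {d : ℕ} {p m : ℤ} {A : ℕ → ℤ} {r e : ℕ} (eq : d ∸ suc r ≡ suc e) where

  matB-leading : matB d p m A (suc r) (suc e) ≡ p
  matB-leading with suc e ℕ.≟ (d ∸ suc r) | suc (suc e) ℕ.≟ (d ∸ suc r)
  ... | yes _ | _ = refl
  ... | no ≢  | _ = ⊥-elim (≢ (sym eq))

  matB-trailing : matB d p m A (suc r) e ≡ ℤ.- m
  matB-trailing with e ℕ.≟ (d ∸ suc r) | suc e ℕ.≟ (d ∸ suc r)
  ... | yes e≡ | _     = ⊥-elim (ℕₚ.1+n≢n (trans (sym eq) (sym e≡)))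
  ... | no _   | yes _ = refl
  ... | no _   | no ≢  = ⊥-elim (≢ (sym eq))

  matB-elsewhere : ∀ {j} → j ≢ e → j ≢ suc e → matB d p m A (suc r) j ≡ + 0
  matB-elsewhere {j} j≢e j≢1+e with j ℕ.≟ (d ∸ suc r) | suc j ℕ.≟ (d ∸ suc r)
  ... | yes j≡ | _        = ⊥-elim (j≢1+e (trans j≡ eq))
  ... | no _   | yes 1+j≡ = ⊥-elim (j≢e (ℕₚ.suc-injective (trans 1+j≡ eq)))
  ... | no _   | no _     = refl

cvec-below : ∀ {d a p m cd i} → i < d → cvec d a p m cd i ≡ a ℤ.* (p ℤ.^ (d ∸ suc i)) ℤ.* (m ℤ.^ i)
cvec-below {d} {i = i} i<d with i ℕ.<? d
... | yes _  = refl
... | no i≮d = ⊥-elim (i≮d i<d)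

cvec-top : ∀ d {a p m cd} → cvec d a p m cd d ≡ cd
cvec-top d with d ℕ.<? d
... | yes d<d = ⊥-elim (ℕₚ.<-irrefl refl d<d)
... | no _    = refl

-- This is the choice of t_i at i = 0: the modulus m^0 is 1, and 0 is the only integer in [-1/2,
-- 1/2).
twice-unit : ∀ t → ℤ.- (+ 1) ℤ.≤ + 2 ℤ.* t → + 2 ℤ.* t ℤ.< + 1 → t ≡ + 0
twice-unit (+ zero)         _           _                    = refl
twice-unit (+ suc n)        _           (ℤ.+<+ (s≤s ()))
twice-unit (-[1+ zero ])    (ℤ.-≤- ()) _
twice-unit (-[1+ suc n ])   (ℤ.-≤- ()) _

module AlgorithmB (d′ : ℕ) (a p m k N cd : ℤ) (p≢0 : p ≢ + 0)
  (cd-eq : a ℤ.* (m ℤ.^ suc d′) ℤ.- k ℤ.* N ≡ p ℤ.* cd)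
  (g ad kt : ℤ) (a-eq : a ≡ g ℤ.* ad) (k-eq : k ≡ g ℤ.* kt)
  (acoef r t : ℕ → ℤ) (algA : AlgorithmA (suc d′) m p kt N ad acoef r t) where
  open AlgorithmA algA

  d = suc d′
  B = matB d p m acoef
  c = cvec d a p m cd

  r₀ : acoef 0 ≡ r 0
  r₀ = begin
    acoef 0                ≡⟨ ℤₚ.*-identityˡ (acoef 0) ⟨
    + 1 ℤ.* acoef 0        ≡⟨ a-step 0 (s≤s z≤n) ⟩
    r 0 ℤ.+ t 0 ℤ.* p      ≡⟨ cong (λ z → r 0 ℤ.+ z ℤ.* p) (twice-unit (t 0) (t-low 0 (s≤s z≤n)) (t-high 0 (s≤s z≤n))) ⟩
    r 0 ℤ.+ + 0            ≡⟨ ℤₚ.+-identityʳ (r 0) ⟩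
    r 0                    ∎
    where open ≡-Reasoning

  -- Read upwards, `r-step` is the Horner recursion r_{i+1} = p r_i + a_{i+1} m^{i+1}. It starts
  -- from r_0 = a_0, because t_0 = 0.
  horner : ∀ i → i < d → ΣQ (suc i) (λ j → ℤ→ℚ (acoef j ℤ.* (p ℤ.^ (i ∸ j) ℤ.* m ℤ.^ j))) ≡ ℤ→ℚ (r i)
  horner zero    _     = trans (ℚₚ.+-identityˡ _) (cong ℤ→ℚ (trans (ℤₚ.*-identityʳ (acoef 0)) r₀))
  horner (suc i) 1+i<d = begin
    ΣQ (suc i) (term (suc i)) + term (suc i) (suc i)
      ≡⟨ cong₂ _+_ (ΣQ-cong (suc i) λ j j<1+i → shift j (ℕₚ.≤-pred j<1+i)) (cong ℤ→ℚ top) ⟩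
    ΣQ (suc i) (λ j → ℤ→ℚ p * term i j) + ℤ→ℚ (acoef (suc i) ℤ.* m ℤ.^ suc i)
      ≡⟨ cong (_+ ℤ→ℚ (acoef (suc i) ℤ.* m ℤ.^ suc i))
           (trans (ΣQ-*ˡ (suc i) (ℤ→ℚ p) (term i)) (cong (ℤ→ℚ p *_) (horner i i<d))) ⟩
    ℤ→ℚ p * ℤ→ℚ (r i) + ℤ→ℚ (acoef (suc i) ℤ.* m ℤ.^ suc i)
      ≡⟨ cong (_+ ℤ→ℚ (acoef (suc i) ℤ.* m ℤ.^ suc i)) (sym (ℤ→ℚ-homo-* p (r i))) ⟩
    ℤ→ℚ (p ℤ.* r i) + ℤ→ℚ (acoef (suc i) ℤ.* m ℤ.^ suc i)
      ≡⟨ ℤ→ℚ-homo-+ (p ℤ.* r i) (acoef (suc i) ℤ.* m ℤ.^ suc i) ⟨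
    ℤ→ℚ (p ℤ.* r i ℤ.+ acoef (suc i) ℤ.* m ℤ.^ suc i)
      ≡⟨ cong ℤ→ℚ (trans (cong (ℤ._+ acoef (suc i) ℤ.* m ℤ.^ suc i) (r-step i i<d))
           (solveℤ 2 (λ x y → x ⊟ y ⊞ y ≜ x) refl (r (suc i)) (acoef (suc i) ℤ.* m ℤ.^ suc i))) ⟩
    ℤ→ℚ (r (suc i)) ∎
    where
    open ≡-Reasoning
    i<d = ℕₚ.<-trans (ℕₚ.n<1+n i) 1+i<d
    term : ℕ → ℕ → ℚ
    term i j = ℤ→ℚ (acoef j ℤ.* (p ℤ.^ (i ∸ j) ℤ.* m ℤ.^ j))
    shift : ∀ j → j ≤ i → term (suc i) j ≡ ℤ→ℚ p * term i j
    shift j j≤i = trans (cong ℤ→ℚ (trans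
      (cong (λ e → acoef j ℤ.* (p ℤ.^ e ℤ.* m ℤ.^ j)) (ℕₚ.+-∸-assoc 1 j≤i))
      (solveℤ 4 (λ a p P M → a ⊠ (p ⊠ P ⊠ M) ≜ p ⊠ (a ⊠ (P ⊠ M))) refl (acoef j) p (p ℤ.^ (i ∸ j)) (m ℤ.^ j))))
      (ℤ→ℚ-homo-* p (acoef j ℤ.* (p ℤ.^ (i ∸ j) ℤ.* m ℤ.^ j)))
    top : acoef (suc i) ℤ.* (p ℤ.^ (i ∸ i) ℤ.* m ℤ.^ suc i) ≡ acoef (suc i) ℤ.* m ℤ.^ suc i
    top rewrite ℕₚ.n∸n≡0 i = cong (acoef (suc i) ℤ.*_) (ℤₚ.*-identityˡ (m ℤ.^ suc i))

  -- After multiplication by p the summands are a(k̃N - ãm^d) and ã(am^d - kN). The powers of m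
  -- cancel, and a k̃ = ã k since both equal g ã k̃.
  top-relation : a ℤ.* r d′ ℤ.+ ad ℤ.* cd ≡ + 0
  top-relation = [ ⊥-elim ∘ p≢0 , id ]′ (ℤₚ.i*j≡0⇒i≡0∨j≡0 p {a ℤ.* r d′ ℤ.+ ad ℤ.* cd} p*≡0)
    where
    open ≡-Reasoning
    M = m ℤ.^ d
    p*≡0 : p ℤ.* (a ℤ.* r d′ ℤ.+ ad ℤ.* cd) ≡ + 0
    p*≡0 = begin
      p ℤ.* (a ℤ.* r d′ ℤ.+ ad ℤ.* cd)
        ≡⟨ solveℤ 5 (λ p a r ad cd → p ⊠ (a ⊠ r ⊞ ad ⊠ cd) ≜ a ⊠ (p ⊠ r) ⊞ ad ⊠ (p ⊠ cd)) refl p a (r d′) ad cd ⟩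
      a ℤ.* (p ℤ.* r d′) ℤ.+ ad ℤ.* (p ℤ.* cd)
        ≡⟨ cong₂ (λ x y → a ℤ.* x ℤ.+ ad ℤ.* y)
             (trans (r-step d′ (ℕₚ.n<1+n d′)) (cong₂ (λ x y → x ℤ.- y ℤ.* M) r-top top-coef)) (sym cd-eq) ⟩
      a ℤ.* (kt ℤ.* N ℤ.- ad ℤ.* M) ℤ.+ ad ℤ.* (a ℤ.* M ℤ.- k ℤ.* N)
        ≡⟨ cong₂ (λ x y → x ℤ.* (kt ℤ.* N ℤ.- ad ℤ.* M) ℤ.+ ad ℤ.* (x ℤ.* M ℤ.- y ℤ.* N)) a-eq k-eq ⟩
      g ℤ.* ad ℤ.* (kt ℤ.* N ℤ.- ad ℤ.* M) ℤ.+ ad ℤ.* (g ℤ.* ad ℤ.* M ℤ.- g ℤ.* kt ℤ.* N)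
        ≡⟨ solveℤ 5 (λ g ad kt N M →
             g ⊠ ad ⊠ (kt ⊠ N ⊟ ad ⊠ M) ⊞ ad ⊠ (g ⊠ ad ⊠ M ⊟ g ⊠ kt ⊠ N) ≜ conℤ (+ 0)) refl g ad kt N M ⟩
      + 0 ∎

  row-suc : ∀ {i} → i < d′ → d′ ∸ i ≡ suc (d′ ∸ suc i)
  row-suc i<d′ = ℕₚ.+-∸-assoc 1 i<d′

  row-eq : ∀ {i} → i < d′ → d′ ∸ (d′ ∸ suc i) ≡ suc i
  row-eq = ℕₚ.m∸[m∸n]≡n

  leading : ∀ {i} → i < d′ → B (d′ ∸ i) (suc i) ≡ p
  leading {i} i<d′ = trans (cong (λ l → B l (suc i)) (row-suc i<d′)) (matB-leading {d} {p} {m} {acoef} {r = d′ ∸ suc i} (row-eq i<d′))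

  trailing : ∀ {i} → i < d′ → B (d′ ∸ i) i ≡ ℤ.- m
  trailing {i} i<d′ = trans (cong (λ l → B l i) (row-suc i<d′)) (matB-trailing {d} {p} {m} {acoef} {r = d′ ∸ suc i} (row-eq i<d′))

  elsewhere : ∀ {i j} → i < d′ → j ≢ i → j ≢ suc i → B (d′ ∸ i) j ≡ + 0
  elsewhere {i} {j} i<d′ j≢i j≢1+i = trans (cong (λ l → B l j) (row-suc i<d′))
    (matB-elsewhere {d} {p} {m} {acoef} {r = d′ ∸ suc i} (row-eq i<d′) j≢i j≢1+i)

  -- The index counts rows from the bottom: row d-1-i is x^i (px - m) when i < d-1, and there p
  -- c_{i+1} = m c_i. For i = d-1 it is the polynomial row, handled by `horner` and `top-relation`.
  Σ-orthogonal : ∀ i → i ≤ d′ → ΣQ (suc d) (λ j → ℤ→ℚ (B (d′ ∸ i) j ℤ.* c j)) ≡ 0ℚ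
  Σ-orthogonal i i≤d′ with i ℕ.≟ d′
  ... | yes refl rewrite ℕₚ.n∸n≡0 d′ = begin
    ΣQ d (λ j → ℤ→ℚ (acoef j ℤ.* c j)) + ℤ→ℚ (acoef d ℤ.* c d)
      ≡⟨ cong₂ _+_ (ΣQ-cong d λ j j<d → term j j<d) (cong ℤ→ℚ (cong₂ ℤ._*_ top-coef (cvec-top d))) ⟩
    ΣQ d (λ j → ℤ→ℚ a * ℤ→ℚ (acoef j ℤ.* (p ℤ.^ (d′ ∸ j) ℤ.* m ℤ.^ j))) + ℤ→ℚ (ad ℤ.* cd)
      ≡⟨ cong (_+ ℤ→ℚ (ad ℤ.* cd)) (trans
           (ΣQ-*ˡ d (ℤ→ℚ a) (λ j → ℤ→ℚ (acoef j ℤ.* (p ℤ.^ (d′ ∸ j) ℤ.* m ℤ.^ j))))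
           (cong (ℤ→ℚ a *_) (horner d′ (ℕₚ.n<1+n d′)))) ⟩
    ℤ→ℚ a * ℤ→ℚ (r d′) + ℤ→ℚ (ad ℤ.* cd)
      ≡⟨ trans (cong (_+ ℤ→ℚ (ad ℤ.* cd)) (sym (ℤ→ℚ-homo-* a (r d′)))) (sym (ℤ→ℚ-homo-+ (a ℤ.* r d′) (ad ℤ.* cd))) ⟩
    ℤ→ℚ (a ℤ.* r d′ ℤ.+ ad ℤ.* cd)
      ≡⟨ cong ℤ→ℚ top-relation ⟩
    0ℚ ∎
    where
    open ≡-Reasoning
    term : ∀ j → j < d → ℤ→ℚ (acoef j ℤ.* c j) ≡ ℤ→ℚ a * ℤ→ℚ (acoef j ℤ.* (p ℤ.^ (d′ ∸ j) ℤ.* m ℤ.^ j))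
    term j j<d = trans (cong ℤ→ℚ (trans (cong (acoef j ℤ.*_) (cvec-below j<d))
      (solveℤ 4 (λ x a P M → x ⊠ (a ⊠ P ⊠ M) ≜ a ⊠ (x ⊠ (P ⊠ M))) refl (acoef j) a (p ℤ.^ (d′ ∸ j)) (m ℤ.^ j))))
      (ℤ→ℚ-homo-* a (acoef j ℤ.* (p ℤ.^ (d′ ∸ j) ℤ.* m ℤ.^ j)))
  ... | no i≢d′ = begin
    ΣQ (suc d) (λ j → ℤ→ℚ (B (d′ ∸ i) j ℤ.* c j))
      ≡⟨ ΣQ-pair (suc d) i (s≤s (ℕₚ.m<n⇒m<1+n i<d′)) (λ j _ j≢i j≢1+i →
           cong ℤ→ℚ (trans (cong (ℤ._* c j) (elsewhere i<d′ j≢i j≢1+i)) (ℤₚ.*-zeroˡ (c j)))) ⟩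
    ℤ→ℚ (B (d′ ∸ i) i ℤ.* c i) + ℤ→ℚ (B (d′ ∸ i) (suc i) ℤ.* c (suc i))
      ≡⟨ ℤ→ℚ-homo-+ (B (d′ ∸ i) i ℤ.* c i) (B (d′ ∸ i) (suc i) ℤ.* c (suc i)) ⟨
    ℤ→ℚ (B (d′ ∸ i) i ℤ.* c i ℤ.+ B (d′ ∸ i) (suc i) ℤ.* c (suc i))
      ≡⟨ cong ℤ→ℚ (trans
           (cong₂ ℤ._+_
             (cong₂ ℤ._*_ (trailing i<d′) (trans (cvec-below (ℕₚ.m<n⇒m<1+n i<d′))
               (cong (λ e → a ℤ.* (p ℤ.^ e) ℤ.* m ℤ.^ i) (row-suc i<d′))))
             (cong₂ ℤ._*_ (leading i<d′) (cvec-below (s≤s i<d′))))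
           (solveℤ 5 (λ a p m P M → (⊟ m) ⊠ (a ⊠ (p ⊠ P) ⊠ M) ⊞ p ⊠ (a ⊠ P ⊠ (m ⊠ M)) ≜ conℤ (+ 0)) refl
             a p m (p ℤ.^ (d′ ∸ suc i)) (m ℤ.^ i))) ⟩
    0ℚ ∎
    where
    open ≡-Reasoning
    i<d′ = ℕₚ.≤∧≢⇒< i≤d′ i≢d′

  module _ (s : ℕ) (S≢0 : ℕ→ℚ s ≢ 0ℚ) (a≢0 : a ≢ + 0) (C : ℕ → ℕ → ℤ)
    (C∈B : RowSpanIn d C B) (B∈C : RowSpanIn d B C) where
    private
      S = ℕ→ℚ s
      w = dualVector d s c
      b = scaleRows C s
      -- In reverse order the rows of B, without the constant-term column, are lower triangular.
      b′ : ℕ → Vecℚ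
      b′ i = scaleRows B s (d′ ∸ i)
      U = proj₁ C∈B
      V = proj₁ B∈C
      P = ℤ→ℚ (p ℤ.^ d′)
      τ = S ^ℚ triangular (suc d)

      B⊥w : ∀ l → l < d → dot (suc d) (scaleRows B s l) w ≡ 0ℚ
      B⊥w l l<d = trans (dot-dualVector d s B c l) (trans
        (cong ((S ^ℚ d) *_) (subst (λ i → ΣQ (suc d) (λ j → ℤ→ℚ (B i j ℤ.* c j)) ≡ 0ℚ)
          (ℕₚ.m∸[m∸n]≡n (ℕₚ.≤-pred l<d)) (Σ-orthogonal (d′ ∸ l) (ℕₚ.m∸n≤m d′ l))))
        (ℚₚ.*-zeroʳ (S ^ℚ d)))

      b⊥w : ∀ i → i < d → dot (suc d) (b i) w ≡ 0ℚ
      b⊥w i i<d = begin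
        dot (suc d) (b i) w
          ≡⟨ dot-congˡ (suc d) {b i} {λ j → ΣQ d (λ l → ℤ→ℚ (U i l) * scaleRows B s l j)} w
               (λ j j<1+d → scaleRows-span d s B C U i j (proj₂ C∈B i j i<d (ℕₚ.≤-pred j<1+d))) ⟩
        dot (suc d) (λ j → ΣQ d (λ l → ℤ→ℚ (U i l) * scaleRows B s l j)) w
          ≡⟨ dot-Σˡ (suc d) d (λ l → ℤ→ℚ (U i l)) (scaleRows B s) w ⟩
        ΣQ d (λ l → ℤ→ℚ (U i l) * dot (suc d) (scaleRows B s l) w)
          ≡⟨ ΣQ-zero d (λ l l<d → trans (cong (ℤ→ℚ (U i l) *_) (B⊥w l l<d)) (ℚₚ.*-zeroʳ (ℤ→ℚ (U i l)))) ⟩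
        0ℚ ∎
        where open ≡-Reasoning

      row< : ∀ i → d′ ∸ i < d
      row< i = s≤s (ℕₚ.m∸n≤m d′ i)

      b′≡Vb : ∀ i j → i < d → j < suc d → b′ i j ≡ ΣQ d (λ l → ℤ→ℚ (V (d′ ∸ i) l) * b l j)
      b′≡Vb i j _ j<1+d = scaleRows-span d s C B V (d′ ∸ i) j (proj₂ B∈C (d′ ∸ i) j (row< i) (ℕₚ.≤-pred j<1+d))

      b′-lower : ∀ i j → i < j → j < d → b′ i (suc j) ≡ 0ℚ
      b′-lower i j i<j j<d = trans
        (cong (λ z → ℤ→ℚ z * (S ^ℚ suc j)) (elsewhere (ℕₚ.<-≤-trans i<j (ℕₚ.≤-pred j<d))
          (λ 1+j≡i → ℕₚ.<⇒≢ (ℕₚ.m<n⇒m<1+n i<j) (sym 1+j≡i))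
          (λ 1+j≡1+i → ℕₚ.<⇒≢ i<j (sym (ℕₚ.suc-injective 1+j≡1+i)))))
        (ℚₚ.*-zeroˡ (S ^ℚ suc j))

      Π-leading : ∀ n → ΠQ n (λ i → ℤ→ℚ p * (S ^ℚ suc i)) ≡ ℤ→ℚ (p ℤ.^ n) * (S ^ℚ triangular (suc n))
      Π-leading zero    = refl
      Π-leading (suc n) = begin
        ΠQ n (λ i → ℤ→ℚ p * (S ^ℚ suc i)) * (ℤ→ℚ p * (S ^ℚ suc n))
          ≡⟨ cong (_* (ℤ→ℚ p * (S ^ℚ suc n))) (Π-leading n) ⟩
        ℤ→ℚ (p ℤ.^ n) * (S ^ℚ triangular (suc n)) * (ℤ→ℚ p * (S ^ℚ suc n))
          ≡⟨ solve 4 (λ x y z u → x :* y :* (z :* u) := z :* x :* (y :* u)) refl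
               (ℤ→ℚ (p ℤ.^ n)) (S ^ℚ triangular (suc n)) (ℤ→ℚ p) (S ^ℚ suc n) ⟩
        ℤ→ℚ p * ℤ→ℚ (p ℤ.^ n) * ((S ^ℚ triangular (suc n)) * (S ^ℚ suc n))
          ≡⟨ cong₂ _*_ (ℤ→ℚ-homo-* p (p ℤ.^ n)) (^ℚ-+ S (triangular (suc n)) (suc n)) ⟨
        ℤ→ℚ (p ℤ.^ suc n) * (S ^ℚ triangular (suc (suc n))) ∎
        where open ≡-Reasoning

      diagonal : ΠQ d (λ i → b′ i (suc i)) ≡ P * ℤ→ℚ ad * τ
      diagonal = begin
        ΠQ d′ (λ i → b′ i (suc i)) * b′ d′ d
          ≡⟨ cong₂ _*_ (trans (ΠQ-cong d′ λ i i<d′ → cong (λ z → ℤ→ℚ z * (S ^ℚ suc i)) (leading i<d′)) (Π-leading d′))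
               (cong (λ z → ℤ→ℚ z * (S ^ℚ d)) (trans (cong (λ l → B l d) (ℕₚ.n∸n≡0 d′)) top-coef)) ⟩
        P * (S ^ℚ triangular d) * (ℤ→ℚ ad * (S ^ℚ d))
          ≡⟨ solve 4 (λ x y z u → x :* y :* (z :* u) := x :* z :* (y :* u)) refl
               P (S ^ℚ triangular d) (ℤ→ℚ ad) (S ^ℚ d) ⟩
        P * ℤ→ℚ ad * ((S ^ℚ triangular d) * (S ^ℚ d))
          ≡⟨ cong (P * ℤ→ℚ ad *_) (^ℚ-+ S (triangular d) d) ⟨
        P * ℤ→ℚ ad * τ ∎
        where open ≡-Reasoning

      w₀ : w 0 ≡ ℤ→ℚ a * P * (S ^ℚ d)
      w₀ = cong (_* (S ^ℚ d)) (trans (cong ℤ→ℚ (trans (cvec-below {d} {a} {p} {m} {cd} (s≤s z≤n)) (ℤₚ.*-identityʳ (a ℤ.* p ℤ.^ d′))))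
        (ℤ→ℚ-homo-* a (p ℤ.^ d′)))

      P≢0 : P ≢ 0ℚ
      P≢0 = ℤ→ℚ-≢0 (p≢0 ∘ ℤₚ.i^n≡0⇒i≡0 p d′)

      *-≢0 : ∀ {x y} → x ≢ 0ℚ → y ≢ 0ℚ → x * y ≢ 0ℚ
      *-≢0 x≢0 y≢0 = y≢0 ∘ *-cancel-0 x≢0

      ad≢0 : ad ≢ + 0
      ad≢0 ad≡0 = a≢0 (trans a-eq (trans (cong (g ℤ.*_) ad≡0) (ℤₚ.*-zeroʳ g)))

      w₀≢0 : w 0 ≢ 0ℚ
      w₀≢0 = subst (_≢ 0ℚ) (sym w₀) (*-≢0 (*-≢0 (ℤ→ℚ-≢0 a≢0) P≢0) (^ℚ-≢0 d S≢0))

      D≢0 : ΠQ d (λ i → b′ i (suc i)) ≢ 0ℚ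
      D≢0 = subst (_≢ 0ℚ) (sym diagonal) (*-≢0 (*-≢0 P≢0 (ℤ→ℚ-≢0 ad≢0)) (^ℚ-≢0 (triangular (suc d)) S≢0))

      Π = ΠQ d (GramSchmidt.sqnorm (suc d) b)

      V-integral : ∀ i l → Integral (ℤ→ℚ (V (d′ ∸ i) l))
      V-integral i l = V (d′ ∸ i) l , refl

    gramSchmidt-pos : 0ℚ ℚ.< Π
    gramSchmidt-pos = volume-pos w b b′ (λ i l → ℤ→ℚ (V (d′ ∸ i) l)) V-integral b′≡Vb b⊥w
      (λ i _ → B⊥w (d′ ∸ i) (row< i)) b′-lower w₀≢0 D≢0

    -- In W D² / w_0² the powers of p cancel and (ã/a)² remains. The exponent of s beside the norm
    -- of c is d from W, d(d+1) from D² and -2d from w_0², in total d².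
    gramSchmidt-≤ : let q = ℤ→ℚ ad ÷₀ ℤ→ℚ a in
      Π ℚ.≤ (S ^ℚ (d ℕ.* d)) * (q * q) * norm2sInv² d c s
    gramSchmidt-≤ = cancel-≤ (square-pos (*-≢0 (*-≢0 (ℤ→ℚ-≢0 a≢0) P≢0) (^ℚ-≢0 d S≢0))) (begin
      Π * (α * P * σ * (α * P * σ))
        ≡⟨ cong (λ z → Π * (z * z)) w₀ ⟨
      Π * (w 0 * w 0)
        ≤⟨ volume-≤ w b b′ (λ i l → ℤ→ℚ (V (d′ ∸ i) l)) V-integral b′≡Vb b⊥w
             (λ i _ → B⊥w (d′ ∸ i) (row< i)) b′-lower w₀≢0 D≢0 ⟩
      dot (suc d) w w * (D * D)
        ≡⟨ cong₂ (λ x y → x * (y * y)) (norm2sInv²-scaled d c s S≢0) (trans diagonal (cong (λ z → P * z * τ) (sym q*α))) ⟩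
      σ * ν * (P * (q * α) * τ * (P * (q * α) * τ))
        ≡⟨ solve 6 (λ σ ν P q α τ → σ :* ν :* (P :* (q :* α) :* τ :* (P :* (q :* α) :* τ))
             := σ :* ν :* (P :* (q :* α) :* (P :* (q :* α))) :* (τ :* τ)) refl σ ν P q α τ ⟩
      σ * ν * (P * (q * α) * (P * (q * α))) * (τ * τ)
        ≡⟨ cong (σ * ν * (P * (q * α) * (P * (q * α))) *_) τ² ⟩
      σ * ν * (P * (q * α) * (P * (q * α))) * ((S ^ℚ (d ℕ.* d)) * σ)
        ≡⟨ solve 6 (λ σ ν P q α ω → σ :* ν :* (P :* (q :* α) :* (P :* (q :* α))) :* (ω :* σ)
             := ω :* (q :* q) :* ν :* (α :* P :* σ :* (α :* P :* σ))) refl σ ν P q α (S ^ℚ (d ℕ.* d)) ⟩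
      (S ^ℚ (d ℕ.* d)) * (q * q) * ν * (α * P * σ * (α * P * σ)) ∎)
      where
      open ℚₚ.≤-Reasoning
      α = ℤ→ℚ a
      q = ℤ→ℚ ad ÷₀ α
      σ = S ^ℚ d
      ν = norm2sInv² d c s
      D = ΠQ d (λ i → b′ i (suc i))
      q*α : q * α ≡ ℤ→ℚ ad
      q*α = ÷₀-* (ℤ→ℚ ad) α λ α≡0 → ⊥-elim (ℤ→ℚ-≢0 a≢0 α≡0)
      τ² : τ * τ ≡ (S ^ℚ (d ℕ.* d)) * σ
      τ² = trans (sym (^ℚ-double S (triangular (suc d)))) (trans
        (cong (S ^ℚ_) (trans (ℕₚ.*-comm 2 (triangular (suc d)))
          (trans (triangular-double (suc d)) (ℕₚ.+-comm d (d ℕ.* d)))))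
        (^ℚ-+ S (d ℕ.* d) d))

    -- The squared length of an integral vector is an integer, and it cannot be 0 because the
    -- product of all `sqnorm` is positive.
    sqnorm₀≥1 : 1ℚ ℚ.≤ GramSchmidt.sqnorm (suc d) b 0
    sqnorm₀≥1 = integral-pos⇒≥1
      (subst Integral (GramSchmidt.sqnorm-first (suc d) b) (integral-ΣQ (suc d) λ j → integral-* (entry j) (entry j)))
      (nonNeg∧≢0⇒pos (dot-self-nonNeg (suc d) (gs (suc d) b 0)) λ ≡0 →
        ℚₚ.<-irrefl refl (subst (0ℚ ℚ.<_) (ΠQ-zero d 0 (s≤s z≤n) ≡0) gramSchmidt-pos))
      where
      entry : ∀ j → Integral (b 0 j)
      entry j = integral-* (C 0 j , refl) (integral-^ j (+ s , refl))

theorem4p6 :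
    (d : ℕ) → 2 ≤ d →
    (a p m k N : ℤ) →
    a ≢ + 0 → p ≢ + 0 → m ≢ + 0 → k ≢ + 0 → + 0 ℤ.< N →
    gcd m p ≡ + 1 → gcd (a ℤ.* p) N ≡ + 1 →
    (cd : ℤ) → a ℤ.* (m ℤ.^ d) ℤ.- k ℤ.* N ≡ p ℤ.* cd → cd ≢ + 0 →
    (s : ℕ) → 1 ≤ s →
    -- step (1): g = gcd(a, c_d), ad = a/g (= ã), kt = k/g
    (ad kt : ℤ) → a ≡ gcd a cd ℤ.* ad → k ≡ gcd a cd ℤ.* kt →
    (acoef r t : ℕ → ℤ) → AlgorithmA d m p kt N ad acoef r t →
    -- step (2): C S is an LLL-reduced basis of the lattice spanned by B S
    (C : ℕ → ℕ → ℤ) → IsLLLBasisOf d s (matB d p m acoef) C →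
    -- step (3) and the claim, for i = 1, 2 (f_i = row i-1 of C):
    (i : ℕ) → 1 ≤ i → i ≤ 2 →
    let f = C (i ∸ 1)
        e = deg (suc d) f
        sQ = ℕ→ℚ s
        ã/a = ℤ→ℚ ad ÷₀ ℤ→ℚ a
    in ((sQ ^ℚ e) ℚ.* norm2s² (suc d) f s) ^ℚ (suc d ∸ i)
         ℚ.≤ (ℕ→ℚ 2 ^ℚ ((d ℕ.* (d ∸ 1)) ℕ./ 2)) ℚ.* (sQ ^ℚ (d ℕ.* d))
             ℚ.* (ã/a ℚ.* ã/a) ℚ.* norm2sInv² d (cvec d a p m cd) s
theorem4p6 (suc d′) (s≤s 1≤d′) a p m k N a≢0 p≢0 _ _ _ _ _ cd cd-eq _ s 1≤s ad kt a-eq k-eq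
  acoef r t algA C (C∈B , B∈C , reduced) = bound
  where
  module L = AlgorithmB d′ a p m k N cd p≢0 cd-eq (gcd a cd) ad kt a-eq k-eq acoef r t algA
  d = suc d′
  S = ℕ→ℚ s
  b = scaleRows C s
  q = ℤ→ℚ ad ÷₀ ℤ→ℚ a
  ν = norm2sInv² d (cvec d a p m cd) s
  open GramSchmidt (suc d) b using (sqnorm)
  S≢0 : S ≢ 0ℚ
  S≢0 = ℤ→ℚ-≢0 λ s≡0 → ℕₚ.<⇒≢ 1≤s (sym (ℤₚ.+-injective s≡0))
  -- `k` is kept apart from `d` because `power-bound` yields the indices d + 0 and d′ + 1, which
  -- equal `d` only up to a proof.
  conclude : ∀ i k → k ≡ d →
    (dot (suc d) (b i) (b i) ^ℚ (suc d ∸ suc i)) ℚ.≤ (2ℚ ^ℚ triangular k) * ΠQ k sqnorm →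
    (((S ^ℚ deg (suc d) (C i)) * norm2s² (suc d) (C i) s) ^ℚ (suc d ∸ suc i))
      ℚ.≤ (2ℚ ^ℚ ((d ℕ.* (d ∸ 1)) ℕ./ 2)) * (S ^ℚ (d ℕ.* d)) * (q * q) * ν
  conclude i _ refl x≤ = begin
    ((S ^ℚ deg (suc d) (C i)) * norm2s² (suc d) (C i) s) ^ℚ (suc d ∸ suc i)
      ≡⟨ cong (_^ℚ (suc d ∸ suc i)) (norm2s²-scaled d C s i S≢0) ⟩
    dot (suc d) (b i) (b i) ^ℚ (suc d ∸ suc i)
      ≤⟨ x≤ ⟩
    (2ℚ ^ℚ triangular d) * ΠQ d sqnorm
      ≤⟨ ℚₚ.*-monoˡ-≤-nonNeg (2ℚ ^ℚ triangular d) {{ℚ.nonNegative (^ℚ-nonNeg (triangular d) 2ℚ≥0)}}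
           (L.gramSchmidt-≤ s S≢0 a≢0 C C∈B B∈C) ⟩
    (2ℚ ^ℚ triangular d) * ((S ^ℚ (d ℕ.* d)) * (q * q) * ν)
      ≡⟨ solve 4 (λ x y z u → x :* (y :* z :* u) := x :* y :* z :* u) refl
           (2ℚ ^ℚ triangular d) (S ^ℚ (d ℕ.* d)) (q * q) ν ⟩
    (2ℚ ^ℚ triangular d) * (S ^ℚ (d ℕ.* d)) * (q * q) * ν
      ≡⟨ cong (λ e → (2ℚ ^ℚ e) * (S ^ℚ (d ℕ.* d)) * (q * q) * ν) (triangular-half d) ⟨
    (2ℚ ^ℚ ((d ℕ.* (d ∸ 1)) ℕ./ 2)) * (S ^ℚ (d ℕ.* d)) * (q * q) * ν ∎
    where open ℚₚ.≤-Reasoning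
  bound : ∀ i → 1 ≤ i → i ≤ 2 →
    (((S ^ℚ deg (suc d) (C (i ∸ 1))) * norm2s² (suc d) (C (i ∸ 1)) s) ^ℚ (suc d ∸ i))
      ℚ.≤ (2ℚ ^ℚ ((d ℕ.* (d ∸ 1)) ℕ./ 2)) * (S ^ℚ (d ℕ.* d)) * (q * q) * ν
  bound (suc zero) _ _ = conclude 0 (d ℕ.+ 0) (ℕₚ.+-identityʳ d)
    (power-bound {f = sqnorm} (dot-self-nonNeg (suc d) (b 0)) d 0
      (λ i i<d → subst (λ l → dot (suc d) (b 0) (b 0) ℚ.≤ (2ℚ ^ℚ l) * sqnorm l) (sym (ℕₚ.+-identityʳ i))
        (first-bound reduced i i<d))
      ℚₚ.≤-refl)
  -- With o = 1 the factor |b*_0|² is left out of the d-1 bounds, matching the exponent d+1-2. It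
  -- enters through the extra premise, which is 1 ≤ |b*_0|² since `triangular 1` is 0.
  bound (suc (suc zero)) _ _ = conclude 1 (d′ ℕ.+ 1) (ℕₚ.+-comm d′ 1)
    (power-bound {f = sqnorm} (dot-self-nonNeg (suc d) (b 1)) d′ 1
      (λ i i<d′ → subst (λ l → dot (suc d) (b 1) (b 1) ℚ.≤ (2ℚ ^ℚ l) * sqnorm l) (ℕₚ.+-comm 1 i)
        (second-bound reduced i (s≤s i<d′)))
      (subst (1ℚ ℚ.≤_) (solve 1 (λ x → x := con 1ℚ :* (con 1ℚ :* x)) refl (sqnorm 0))
        (L.sqnorm₀≥1 s S≢0 a≢0 C C∈B B∈C)))
  bound (suc (suc (suc i))) _ (s≤s (s≤s ()))
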